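{- Let $k\leq n-2$ and $m\geq1$, or let $k=n-1$ and $m\geq2$. If $G$ is an $m$-saturated crowded $(n-k)$-parade on $n$ vertices, then $G$ is minor maximal amongst graphs with $n$ vertices, at most $m$ parallel edges between any given pair of vertices, and spectator floor $k$.
   Context: All graphs are finite, have at least one vertex, have no loops, and may have multiple (parallel) edges. A minor of $H$ is any graph obtained from $H$ by a sequence of: deleting an isolated vertex, deleting an edge, contracting an edge that has no edge parallel to it. A graph $G$ in a class $\mathcal{C}$ is minor maximal in $\mathcal{C}$ if $G\in\mathcal{C}$ and no graph in $\mathcal{C}$ other than $G$ has $G$ as a minor. A unique shortest path is a shortest $u$–$v$ path $P$ such that every $u$–$v$ path with the same number of vertices is identical to $P$, where two paths with different edge sequences are different even if their vertex sequences agree; a single vertex is a unique shortest path. The parade number $\mathrm{usp}(G)$ is the largest number of vertices of a unique shortest path in $G$; a parade is a unique shortest path with $\mathrm{usp}(G)$ vertices. The spectator number is $\mathrm{sp}(G)=|V(G)|-\mathrm{usp}(G)$. The spectator floor $\lfloor \mathrm{sp}\rfloor(G)$ is the minimum of $\mathrm{sp}(H)$ over all graphs $H$ of which $G$ is a minor. For $p\geq2$, a crowded $p$-parade is a graph $G$ with a parade $P$ of $p$ vertices such that (i) every vertex outside $P$ is adjacent to exactly two vertices of $P$, and those two vertices are adjacent to each other; (ii) any two vertices outside $P$ that are adjacent to a common vertex of $P$ are adjacent to each other. An $m$-saturated crowded $p$-parade ($p\geq 2$) is a crowded $p$-parade in which every edge not in the parade has exactly $m$ parallel copies (including itself). An $m$-saturated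 crowded $1$-parade is a graph in which every pair of vertices is joined by exactly $m$ edges. -}

module Defs where

open import Data.Nat using (ℕ; suc; _+_; _∸_; _≤_; _<_; NonZero)
open import Data.Fin using (Fin; punchIn; cast)
open import Data.Fin.Permutation using (Permutation; _⟨$⟩ʳ_)
open import Data.List using (List; []; _∷_; length)
open import Data.List.Membership.Propositional using (_∈_; _∉_)
open import Data.List.Relation.Unary.Unique.Propositional using (Unique)
open import Data.Product using (Σ-syntax; ∃-syntax; _×_; _,_)
open import Data.Sum using (_⊎_)
open import Data.Empty using (⊥)
open import Relation.Nullary using (¬_)
open import Relation.Binary.PropositionalEquality using (_≡_; _≢_)

-- A loopless multigraph with vertex set Fin n. The edges joining u and v
-- are labelled by Fin (mult u v); the label i at (u , v) and the label
-- cast _ i at (v , u) name the same edge.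
record Graph (n : ℕ) : Set where
  field
    nonEmpty  : NonZero n
    mult      : Fin n → Fin n → ℕ
    mult-sym  : ∀ u v → mult u v ≡ mult v u
    mult-loop : ∀ v → mult v v ≡ 0

open Graph public

Adjacent : ∀ {n} → Graph n → Fin n → Fin n → Set
Adjacent G u v = 0 < mult G u v

infix 4 _≅_ _⟶_ _≼_

_≅_ : ∀ {n n′} → Graph n → Graph n′ → Set
_≅_ {n} {n′} G H =
  Σ[ π ∈ Permutation n n′ ] (∀ u v → mult G u v ≡ mult H (π ⟨$⟩ʳ u) (π ⟨$⟩ʳ v))

-- H ⟶ G: the graph G results from H by one elementary operation. Removing
-- a vertex v renumbers the others along punchIn v.
data _⟶_ : ∀ {N n} → Graph N → Graph n → Set where

  deleteVertex : ∀ {n} {H : Graph (suc n)} {G : Graph n} (v : Fin (suc n)) →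
    (∀ u → mult H v u ≡ 0) →
    (∀ i j → mult G i j ≡ mult H (punchIn v i) (punchIn v j)) →
    H ⟶ G

  deleteEdge : ∀ {n} {H G : Graph n} (u v : Fin n) →
    mult H u v ≡ suc (mult G u v) →
    (∀ x y → ¬ (x ≡ u × y ≡ v) → ¬ (x ≡ v × y ≡ u) → mult G x y ≡ mult H x y) →
    H ⟶ G

  -- The unique edge between v and punchIn v w is contracted, w being the
  -- merged vertex. The entries mult G i w are fixed by symmetry, and
  -- mult G w w by looplessness.
  contractEdge : ∀ {n} {H : Graph (suc n)} {G : Graph n}
    (v : Fin (suc n)) (w : Fin n) →
    mult H v (punchIn v w) ≡ 1 →
    (∀ j → j ≢ w →
      mult G w j ≡ mult H (punchIn v w) (punchIn v j) + mult H v (punchIn v j)) →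
    (∀ i j → i ≢ w → j ≢ w →
      mult G i j ≡ mult H (punchIn v i) (punchIn v j)) →
    H ⟶ G

-- G ≼ H: G is a minor of H. Graphs are considered up to isomorphism.
data _≼_ {n} (G : Graph n) : ∀ {N} → Graph N → Set where
  iso  : ∀ {N} {H : Graph N} → G ≅ H → G ≼ H
  step : ∀ {N N′} {H : Graph N} {K : Graph N′} → H ⟶ K → G ≼ K → G ≼ H

GraphClass : Set₁
GraphClass = ∀ {n} → Graph n → Set

MinorMaximal : GraphClass → ∀ {n} → Graph n → Set
MinorMaximal C G = C G × (∀ {N} (H : Graph N) → C H → G ≼ H → H ≅ G)

module _ {n : ℕ} (G : Graph n) where

  data Walk : Fin n → Fin n → Set where
    stop : ∀ u → Walk u u
    go   : ∀ {u v w} → Fin (mult G u v) → Walk v w → Walk u w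

  -- An edge together with a direction of traversal.
  Dart : Set
  Dart = Σ[ u ∈ Fin n ] Σ[ v ∈ Fin n ] Fin (mult G u v)

  reverse : Dart → Dart
  reverse (u , v , e) = v , u , cast (mult-sym G u v) e

module _ {n : ℕ} {G : Graph n} where

  vertices : ∀ {u v} → Walk G u v → List (Fin n)
  vertices (stop u)       = u ∷ []
  vertices (go {u = u} e W) = u ∷ vertices W

  darts : ∀ {u v} → Walk G u v → List (Dart G)
  darts (stop u)               = []
  darts (go {u = u} {v = v} e W) = (u , v , e) ∷ darts W

  ∣_∣ᵥ : ∀ {u v} → Walk G u v → ℕ
  ∣ W ∣ᵥ = length (vertices W)

  IsPath : ∀ {u v} → Walk G u v → Set
  IsPath W = Unique (vertices W)

  IsShortestPath : ∀ {u v} → Walk G u v → Set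
  IsShortestPath {u} {v} P =
    IsPath P × (∀ (Q : Walk G u v) → IsPath Q → ∣ P ∣ᵥ ≤ ∣ Q ∣ᵥ)

  -- Equality in Walk G u v compares edge labels as well as vertices.
  IsUniqueShortestPath : ∀ {u v} → Walk G u v → Set
  IsUniqueShortestPath {u} {v} P =
    IsShortestPath P ×
    (∀ (Q : Walk G u v) → IsPath Q → ∣ Q ∣ᵥ ≡ ∣ P ∣ᵥ → Q ≡ P)

-- ParadeNumber G p: usp(G) = p.
ParadeNumber : ∀ {n} → Graph n → ℕ → Set
ParadeNumber G p =
  (∃[ u ] ∃[ v ] Σ[ P ∈ Walk G u v ] (IsUniqueShortestPath P × ∣ P ∣ᵥ ≡ p)) ×
  (∀ {u v} (Q : Walk G u v) → IsUniqueShortestPath Q → ∣ Q ∣ᵥ ≤ p)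

-- SpectatorNumber G s: sp(G) = s. The subtraction is never truncated,
-- since a path has at most n vertices.
SpectatorNumber : ∀ {n} → Graph n → ℕ → Set
SpectatorNumber {n} G s = ∃[ p ] (ParadeNumber G p × s ≡ n ∸ p)

-- SpectatorFloor G k: ⌊sp⌋(G) = k.
SpectatorFloor : ∀ {n} → Graph n → ℕ → Set
SpectatorFloor G k =
  (∃[ N ] Σ[ H ∈ Graph N ] (G ≼ H × SpectatorNumber H k)) ×
  (∀ {N} (H : Graph N) s → G ≼ H → SpectatorNumber H s → k ≤ s)

module _ {n : ℕ} {G : Graph n} where

  IsParade : ∀ {u v} → Walk G u v → Set
  IsParade P = IsUniqueShortestPath P × ParadeNumber G ∣ P ∣ᵥ

  record IsCrowded {u v} (P : Walk G u v) : Set where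
    field
      parade : IsParade P
      exactlyTwo : ∀ x → x ∉ vertices P →
        ∃[ a ] ∃[ b ]
          ( a ∈ vertices P × b ∈ vertices P × a ≢ b
          × Adjacent G x a × Adjacent G x b
          × (∀ c → c ∈ vertices P → Adjacent G x c → c ≡ a ⊎ c ≡ b)
          × Adjacent G a b )
      common : ∀ x y → x ∉ vertices P → y ∉ vertices P → x ≢ y →
        (∃[ c ] (c ∈ vertices P × Adjacent G x c × Adjacent G y c)) →
        Adjacent G x y

  _∈ₑ_ : ∀ {u v} → Dart G → Walk G u v → Set
  d ∈ₑ P = d ∈ darts P ⊎ reverse G d ∈ darts P

  IsSaturated : ∀ {u v} → ℕ → Walk G u v → Set
  IsSaturated m P =
    ∀ x y (e : Fin (mult G x y)) → ¬ ((x , y , e) ∈ₑ P) → mult G x y ≡ m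

-- SaturatedCrowdedParade m p G: G is an m-saturated crowded p-parade.
SaturatedCrowdedParade : ∀ {n} → ℕ → ℕ → Graph n → Set
SaturatedCrowdedParade m 0 G = ⊥
SaturatedCrowdedParade m 1 G = ∀ u v → u ≢ v → mult G u v ≡ m
SaturatedCrowdedParade m p@(suc (suc _)) G =
  ∃[ u ] ∃[ v ] Σ[ P ∈ Walk G u v ]
    (∣ P ∣ᵥ ≡ p × IsCrowded P × IsSaturated m P)

record BoundedClass (n m k : ℕ) {N : ℕ} (G : Graph N) : Set where
  field
    order    : N ≡ n
    parallel : ∀ u v → mult G u v ≤ m
    floor    : SpectatorFloor G k

{-# OPTIONS --safe #-}

-- Let K be a host graph of H whose parade leaves s spectators, and call a vertex
-- of H interior if its branch set lies on that parade. Interior branch sets are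
-- disjoint subpaths, so they are ordered; let a and b be the extreme ones. Levels
-- (distances from the start of the parade) are 1-Lipschitz, hence the branch sets
-- along any walk Q of H from a to b meet every level in between. So an interior
-- vertex missed by Q is charged to a spectator of K in a branch set of Q on the
-- same level, and a non-interior vertex missed by Q to a spectator in its own
-- branch set; this is injective and gives n ≤ |Q| + s. In case of equality the
-- branch sets of Q meet each level once, and uniqueness of the parade, used level
-- by level downwards from b, puts them on the parade: Q visits exactly the
-- interior vertices.
--
-- A crowded (q+1)-parade is an interval graph of diameter at most q, so s ≥ k. If
-- H contains it and s = k, then every walk of H from a to b with at most q + 1
-- vertices visits exactly the interior vertices, and interior vertices are joined
-- by at most one edge. An additional edge of H creates another such walk or a
-- shorter one.
module Submission where

open import Data.Nat
open import Data.Nat.Properties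
open import Data.Fin using (Fin; toℕ; fromℕ<; punchIn; punchOut; splitAt; join)
  renaming (zero to fzero; suc to fsuc)
import Data.Fin.Properties as Fin
open import Data.Fin.Permutation
  using (Permutation; _⟨$⟩ʳ_; _⟨$⟩ˡ_; inverseˡ; inverseʳ; flip; _∘ₚ_; ↔⇒≡) renaming (id to idₚ)
open import Data.List using (List; lookup)
open import Data.List.Membership.Propositional using (_∈_; _∉_)
open import Data.List.Membership.Propositional.Properties using (∈-lookup)
open import Data.List.Relation.Unary.All using ([]; _∷_)
open import Data.List.Relation.Unary.All.Properties using (¬Any⇒All¬)
open import Data.List.Relation.Unary.AllPairs using ([]; _∷_)
open import Data.List.Relation.Unary.Any using (here; there; any?; index)
open import Data.List.Relation.Unary.Any.Properties using (lookup-index)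
open import Data.Maybe using (Maybe; just; nothing; _>>=_)
open import Data.Maybe.Properties using (just-injective; ≡-dec)
open import Data.Product using (Σ-syntax; ∃; ∃-syntax; ∃₂; _×_; _,_; proj₁; proj₂)
open import Data.Sum using (_⊎_; inj₁; inj₂)
open import Data.Sum.Properties using (inj₂-injective)
open import Function using (_∘_)
open import Function.Definitions using (Injective)
open import Relation.Binary.Construct.Closure.ReflexiveTransitive using (Star; ε; _◅_; _◅◅_; gmap)
open import Relation.Binary.Definitions using (tri<; tri≈; tri>)
open import Relation.Binary.PropositionalEquality
open import Relation.Nullary using (¬_; Dec; yes; no; contradiction)
open import Relation.Nullary.Decidable using (_⊎-dec_; _×-dec_; ¬?; decidable-stable)
open import Defs

-- Walks

_∈?_ : ∀ {n} (x : Fin n) (xs : List (Fin n)) → Dec (x ∈ xs)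
x ∈? xs = any? (x Fin.≟_) xs

module _ {n : ℕ} {G : Graph n} where

  adj-sym : ∀ {u v} → Adjacent G u v → Adjacent G v u
  adj-sym {u} {v} = subst (0 <_) (mult-sym G u v)

  edge : ∀ {u v} → Adjacent G u v → Fin (mult G u v)
  edge a = fromℕ< a

  edge⇒adj : ∀ {u v} → Fin (mult G u v) → Adjacent G u v
  edge⇒adj e = ≤-<-trans z≤n (Fin.toℕ<n e)

  len : ∀ {u v} → Walk G u v → ℕ
  len (stop _) = 0
  len (go _ W) = suc (len W)

  ∣∣ᵥ≡suc-len : ∀ {u v} (W : Walk G u v) → ∣ W ∣ᵥ ≡ suc (len W)
  ∣∣ᵥ≡suc-len (stop _) = refl
  ∣∣ᵥ≡suc-len (go _ W) = cong suc (∣∣ᵥ≡suc-len W)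

  infixr 5 _⊕_

  _⊕_ : ∀ {u v w} → Walk G u v → Walk G v w → Walk G u w
  stop _ ⊕ Q = Q
  go e P ⊕ Q = go e (P ⊕ Q)

  len-⊕ : ∀ {u v w} (P : Walk G u v) (Q : Walk G v w) → len (P ⊕ Q) ≡ len P + len Q
  len-⊕ (stop _) Q = refl
  len-⊕ (go _ P) Q = cong suc (len-⊕ P Q)

  first∈ : ∀ {u v} (W : Walk G u v) → u ∈ vertices W
  first∈ (stop _) = here refl
  first∈ (go _ _) = here refl

  last∈ : ∀ {u v} (W : Walk G u v) → v ∈ vertices W
  last∈ (stop _) = here refl
  last∈ (go _ W) = there (last∈ W)

  ∈-⊕ʳ : ∀ {u v w x} (P : Walk G u v) (Q : Walk G v w) → x ∈ vertices Q → x ∈ vertices (P ⊕ Q)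
  ∈-⊕ʳ (stop _) Q x∈ = x∈
  ∈-⊕ʳ (go _ P) Q x∈ = there (∈-⊕ʳ P Q x∈)

  ∈-⊕ˡ : ∀ {u v w x} (P : Walk G u v) (Q : Walk G v w) → x ∈ vertices P → x ∈ vertices (P ⊕ Q)
  ∈-⊕ˡ (stop _) Q (here refl) = first∈ Q
  ∈-⊕ˡ (go _ P) Q (here refl) = here refl
  ∈-⊕ˡ (go _ P) Q (there x∈) = there (∈-⊕ˡ P Q x∈)

  ∈-⊕⁻ : ∀ {u v w x} (P : Walk G u v) (Q : Walk G v w) →
    x ∈ vertices (P ⊕ Q) → x ∈ vertices P ⊎ x ∈ vertices Q
  ∈-⊕⁻ (stop _) Q x∈ = inj₂ x∈
  ∈-⊕⁻ (go _ P) Q (here refl) = inj₁ (here refl)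
  ∈-⊕⁻ (go _ P) Q (there x∈) with ∈-⊕⁻ P Q x∈
  ... | inj₁ p = inj₁ (there p)
  ... | inj₂ q = inj₂ q

  reverseWalk : ∀ {u v} → Walk G u v → Walk G v u
  reverseWalk (stop u) = stop u
  reverseWalk (go {u} e W) = reverseWalk W ⊕ go (edge (adj-sym (edge⇒adj e))) (stop u)

  len-reverseWalk : ∀ {u v} (W : Walk G u v) → len (reverseWalk W) ≡ len W
  len-reverseWalk (stop _) = refl
  len-reverseWalk (go e W) =
    trans (len-⊕ (reverseWalk W) _) (trans (cong (_+ 1) (len-reverseWalk W)) (+-comm _ 1))

  ∈-reverseWalk : ∀ {u v x} (W : Walk G u v) → x ∈ vertices (reverseWalk W) → x ∈ vertices W
  ∈-reverseWalk (stop _) x∈ = x∈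
  ∈-reverseWalk (go {u} e W) x∈ with ∈-⊕⁻ (reverseWalk W) _ x∈
  ... | inj₁ p = there (∈-reverseWalk W p)
  ... | inj₂ (here refl) = there (first∈ W)
  ... | inj₂ (there (here refl)) = here refl

  ∈-reverseWalk⁺ : ∀ {u v x} (W : Walk G u v) → x ∈ vertices W → x ∈ vertices (reverseWalk W)
  ∈-reverseWalk⁺ (stop _) x∈ = x∈
  ∈-reverseWalk⁺ (go e W) (here refl) = ∈-⊕ʳ (reverseWalk W) _ (there (here refl))
  ∈-reverseWalk⁺ (go e W) (there x∈) = ∈-⊕ˡ (reverseWalk W) _ (∈-reverseWalk⁺ W x∈)

  from : ∀ {u v x} (W : Walk G u v) → x ∈ vertices W →
    Σ[ Q ∈ Walk G x v ] (len Q ≤ len W × (IsPath W → IsPath Q))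
  from (stop u) (here refl) = stop u , z≤n , λ p → p
  from W@(go _ _) (here refl) = W , ≤-refl , λ p → p
  from (go e W) (there x∈) with from W x∈
  ... | Q , le , path = Q , m≤n⇒m≤1+n le , λ { (_ ∷ p) → path p }

  -- Cutting out the closed part at a repeated vertex makes the walk strictly shorter. The
  -- alternative `Q ≡ W` records that nothing was cut, so a bound on lengths can decide between the
  -- two.
  toPath : ∀ {u v} (W : Walk G u v) →
    Σ[ Q ∈ Walk G u v ] (IsPath Q × (len Q < len W ⊎ Q ≡ W))
  toPath (stop u) = stop u , ([] ∷ []) , inj₂ refl
  toPath (go {u} e W) with toPath W
  ... | Q , path , rel with u ∈? vertices Q
  ... | yes u∈ with from Q u∈
  ... | R , le , path′ = R , path′ path , inj₁ (s≤s (≤-trans le (shorter rel)))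
    where
    shorter : len Q < len W ⊎ Q ≡ W → len Q ≤ len W
    shorter (inj₁ lt) = <⇒≤ lt
    shorter (inj₂ refl) = ≤-refl
  toPath (go {u} e W) | Q , path , inj₁ lt | no u∉ = go e Q , ¬Any⇒All¬ _ u∉ ∷ path , inj₁ (s≤s lt)
  toPath (go {u} e W) | Q , path , inj₂ refl | no u∉ = go e Q , ¬Any⇒All¬ _ u∉ ∷ path , inj₂ refl

  -- `IsUniqueShortestPath` compares `P` with paths only. A walk no longer than `P` cannot shorten
  -- to a path, which would beat `P`; so it is itself a path of the same length.
  uniqueAmongWalks : ∀ {u v} {P : Walk G u v} → IsUniqueShortestPath P →
    (W : Walk G u v) → len W ≤ len P → W ≡ P
  uniqueAmongWalks {P = P} ((_ , shortest) , unique) W le with toPath W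
  ... | Q , path , rel = conclude rel
    where
    P≤Q : len P ≤ len Q
    P≤Q = s≤s⁻¹ (subst₂ _≤_ (∣∣ᵥ≡suc-len P) (∣∣ᵥ≡suc-len Q) (shortest Q path))
    conclude : len Q < len W ⊎ Q ≡ W → W ≡ P
    conclude (inj₁ lt) = contradiction (<-≤-trans lt (≤-trans le P≤Q)) (<-irrefl refl)
    conclude (inj₂ refl) =
      unique W path (trans (∣∣ᵥ≡suc-len W) (trans (cong suc (≤-antisym le P≤Q)) (sym (∣∣ᵥ≡suc-len P))))

  at : ∀ {u v} → Walk G u v → ℕ → Fin n
  -- Positions beyond the end give the last vertex, so that `at∈` holds for every index.
  at (stop u) _ = u
  at (go {u} e W) zero = u
  at (go e W) (suc i) = at W i

  at-zero : ∀ {u v} (W : Walk G u v) → at W 0 ≡ u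
  at-zero (stop _) = refl
  at-zero (go _ _) = refl

  prefix : ∀ {u v} (W : Walk G u v) i → i ≤ len W → Σ[ Q ∈ Walk G u (at W i) ] len Q ≡ i
  prefix (stop u) zero _ = stop u , refl
  prefix (go {u} e W) zero _ = stop u , refl
  prefix (go e W) (suc i) (s≤s le) with prefix W i le
  ... | Q , eq = go e Q , cong suc eq

  suffix : ∀ {u v} (W : Walk G u v) i → i ≤ len W → Σ[ Q ∈ Walk G (at W i) v ] i + len Q ≡ len W
  suffix (stop u) zero _ = stop u , refl
  suffix (go e W) zero _ = go e W , refl
  suffix (go e W) (suc i) (s≤s le) with suffix W i le
  ... | Q , eq = Q , cong suc eq

  at-edge : ∀ {u v} (W : Walk G u v) i → i < len W → Adjacent G (at W i) (at W (suc i))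
  at-edge (go {u} e W) zero lt = subst (Adjacent G u) (sym (at-zero W)) (edge⇒adj e)
  at-edge (go e W) (suc i) (s≤s lt) = at-edge W i lt

  at-⊕ : ∀ {u v w} (P : Walk G u v) (Q : Walk G v w) → at (P ⊕ Q) (len P) ≡ v
  at-⊕ (stop _) Q = at-zero Q
  at-⊕ (go _ P) Q = at-⊕ P Q

  -- Exchanging an edge for a parallel one changes the walk; this excludes parallel edges along a
  -- unique shortest path.
  ⊕-go-injective : ∀ {u v w x} (P : Walk G u v) {e f : Fin (mult G v w)} (Q : Walk G w x) →
    P ⊕ go e Q ≡ P ⊕ go f Q → e ≡ f
  ⊕-go-injective (stop _) Q refl = refl
  ⊕-go-injective (go e P) {e₁} {f} Q eq = ⊕-go-injective P Q (go-injective eq)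
    where
    go-injective : ∀ {u v w} {e : Fin (mult G u v)} {W W′ : Walk G v w} →
      go {u = u} e W ≡ go e W′ → W ≡ W′
    go-injective refl = refl

  at∈ : ∀ {u v} (W : Walk G u v) i → at W i ∈ vertices W
  at∈ (stop _) i = here refl
  at∈ (go _ W) zero = here refl
  at∈ (go _ W) (suc i) = there (at∈ W i)

  ∈⇒at : ∀ {u v x} (W : Walk G u v) → x ∈ vertices W → ∃[ i ] (i ≤ len W × x ≡ at W i)
  ∈⇒at (stop _) (here refl) = 0 , z≤n , refl
  ∈⇒at (go _ W) (here refl) = 0 , z≤n , refl
  ∈⇒at (go _ W) (there x∈) with ∈⇒at W x∈
  ... | i , le , eq = suc i , s≤s le , eq

  ∈-darts⇒∈-vertices : ∀ {u v x y} {e : Fin (mult G x y)} (W : Walk G u v) →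
    (x , y , e) ∈ darts W → x ∈ vertices W × y ∈ vertices W
  ∈-darts⇒∈-vertices (go _ W) (here refl) = here refl , there (first∈ W)
  ∈-darts⇒∈-vertices (go _ W) (there d∈) with ∈-darts⇒∈-vertices W d∈
  ... | x∈ , y∈ = there x∈ , there y∈

fin⇒≤1 : ∀ {a} → (∀ (e f : Fin a) → e ≡ f) → a ≤ 1
fin⇒≤1 {zero} _ = z≤n
fin⇒≤1 {suc zero} _ = ≤-refl
fin⇒≤1 {suc (suc a)} h with h fzero (fsuc fzero)
... | ()

-- Levels along a unique shortest path

-- The consequences of a unique shortest path v 0, …, v q: levels are distances
-- from v 0, capped at q.
record Strip {N : ℕ} (K : Graph N) (q : ℕ) : Set where
  field
    v         : ℕ → Fin N
    level     : Fin N → ℕ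
    level≤    : ∀ w → level w ≤ q
    level-v   : ∀ {i} → i ≤ q → level (v i) ≡ i
    lipschitz : ∀ {u w} → Adjacent K u w → level w ≤ suc (level u)
    v-adj     : ∀ {i} → i < q → Adjacent K (v i) (v (suc i))
    below-v   : ∀ {i w} → i < q → Adjacent K w (v (suc i)) → level w ≡ i → w ≡ v i
    v-simple  : ∀ {i} → i < q → mult K (v i) (v (suc i)) ≤ 1

  -- By `level-v`, a vertex of the path can only be the one on its own level, so membership is a
  -- single decidable equation.
  OnSpine : Fin N → Set
  OnSpine w = w ≡ v (level w)

  onSpine? : ∀ w → Dec (OnSpine w)
  onSpine? w = w Fin.≟ v (level w)

  v-onSpine : ∀ {i} → i ≤ q → OnSpine (v i)
  v-onSpine i≤q = cong v (sym (level-v i≤q))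

  v-injective : ∀ {i j} → i ≤ q → j ≤ q → v i ≡ v j → i ≡ j
  v-injective i≤q j≤q eq = trans (sym (level-v i≤q)) (trans (cong level eq) (level-v j≤q))

  spine : Fin (suc q) → Fin N
  spine i = v (toℕ i)

  spine-onSpine : ∀ i → OnSpine (spine i)
  spine-onSpine i = v-onSpine (s≤s⁻¹ (Fin.toℕ<n i))

  spine-injective : Injective _≡_ _≡_ spine
  spine-injective {i} {j} eq =
    Fin.toℕ-injective (v-injective (s≤s⁻¹ (Fin.toℕ<n i)) (s≤s⁻¹ (Fin.toℕ<n j)) eq)

  q<N : q < N
  q<N = Fin.injective⇒≤ spine-injective

module Levels {N : ℕ} (K : Graph N) (u : Fin N) where

  Within : ℕ → Fin N → Set
  Within zero w = u ≡ w
  Within (suc l) w = Within l w ⊎ ∃[ x ] (Within l x × Adjacent K x w)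

  within? : ∀ l w → Dec (Within l w)
  within? zero w = u Fin.≟ w
  within? (suc l) w = within? l w ⊎-dec Fin.any? (λ x → within? l x ×-dec (0 <? mult K x w))

  within-mono : ∀ {l l′ w} → l ≤′ l′ → Within l w → Within l′ w
  within-mono ≤′-refl r = r
  within-mono (≤′-step le) r = inj₁ (within-mono le r)

  within⇒walk : ∀ l {w} → Within l w → Σ[ W ∈ Walk K u w ] len W ≤ l
  within⇒walk zero refl = stop u , z≤n
  within⇒walk (suc l) (inj₁ r) with within⇒walk l r
  ... | W , le = W , m≤n⇒m≤1+n le
  within⇒walk (suc l) (inj₂ (x , r , a)) with within⇒walk l r
  ... | W , le = W ⊕ go (edge {G = K} a) (stop _) ,
    subst (_≤ suc l) (sym (trans (len-⊕ W _) (+-comm _ 1))) (s≤s le)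

  -- The distance from `u` capped at `l`. Farther vertices, and those that cannot be reached, get
  -- the value `l`.
  dist : ℕ → Fin N → ℕ
  dist zero w = 0
  dist (suc l) w with within? l w
  ... | yes _ = dist l w
  ... | no _ = suc l

  dist≤ : ∀ l w → dist l w ≤ l
  dist≤ zero w = z≤n
  dist≤ (suc l) w with within? l w
  ... | yes _ = m≤n⇒m≤1+n (dist≤ l w)
  ... | no _ = ≤-refl

  within⇒dist≤ : ∀ l {i w} → Within i w → dist l w ≤ i
  within⇒dist≤ zero r = z≤n
  within⇒dist≤ (suc l) {i} {w} r with within? l w
  ... | yes _ = within⇒dist≤ l r
  ... | no ¬r with l <? i
  ... | yes l<i = l<i
  ... | no l≮i = contradiction (within-mono (≤⇒≤′ (≮⇒≥ l≮i)) r) ¬r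

  dist<⇒within : ∀ l {w} → dist l w < l → Within (dist l w) w
  dist<⇒within (suc l) {w} lt with within? l w
  ... | no _ = contradiction lt (<-irrefl refl)
  ... | yes r with dist l w <? l
  ... | yes lt′ = dist<⇒within l lt′
  ... | no ≮l = subst (λ i → Within i w) (≤-antisym (≮⇒≥ ≮l) (dist≤ l w)) r

module _ {N : ℕ} {K : Graph N} {u w : Fin N} (P : Walk K u w) (usp : IsUniqueShortestPath P) where
  open Levels K u
  private
    q = len P

  within-at : ∀ {i} → i ≤ q → Within i (at P i)
  within-at {zero} _ = sym (at-zero P)
  within-at {suc i} lt = inj₂ (at P i , within-at (<⇒≤ lt) , at-edge P i lt)

  private
    splice : ∀ {i j} → j ≤ q → Within i (at P j) → Σ[ W ∈ Walk K u w ] len W + j ≤ i + q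
    splice {i} {j} j≤q r with within⇒walk i r | suffix P j j≤q
    ... | W , le | S , eq = W ⊕ S , (begin
      len (W ⊕ S) + j     ≡⟨ cong (_+ j) (len-⊕ W S) ⟩
      len W + len S + j   ≡⟨ +-assoc (len W) (len S) j ⟩
      len W + (len S + j) ≡⟨ cong (len W +_) (trans (+-comm (len S) j) eq) ⟩
      len W + q           ≤⟨ +-monoˡ-≤ q le ⟩
      i + q               ∎)
      where open ≤-Reasoning

  -- A shortcut to `at P j`, continued along `P`, would give a walk between the ends of `P` with
  -- fewer than `q` edges.
  within-at⇒≥ : ∀ {i j} → j ≤ q → Within i (at P j) → j ≤ i
  within-at⇒≥ {i} {j} j≤q r with splice j≤q r
  ... | W , le = +-cancelʳ-≤ q j i (begin
      j + q       ≡⟨ +-comm j q ⟩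
      q + j       ≤⟨ +-monoˡ-≤ j (q≤ W) ⟩
      len W + j   ≤⟨ le ⟩
      i + q       ∎)
    where
    open ≤-Reasoning
    q≤ : ∀ W → q ≤ len W
    q≤ W with q ≤? len W
    ... | yes p = p
    ... | no ¬p = ≤-reflexive (cong len (sym (uniqueAmongWalks usp W (<⇒≤ (≰⇒> ¬p)))))

  strip : Strip K q
  strip = record
    { v = at P
    ; level = dist q
    ; level≤ = dist≤ q
    ; level-v = level-v
    ; lipschitz = lipschitz
    ; v-adj = λ {i} → at-edge P i
    ; below-v = below
    ; v-simple = simple
    }
    where
    level-v : ∀ {i} → i ≤ q → dist q (at P i) ≡ i
    level-v {i} i≤q = ≤-antisym (within⇒dist≤ q (within-at i≤q)) ge
      where
      ge : i ≤ dist q (at P i)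
      ge with dist q (at P i) <? q
      ... | yes lt = within-at⇒≥ i≤q (dist<⇒within q lt)
      ... | no ≮q = ≤-trans i≤q (≮⇒≥ ≮q)

    lipschitz : ∀ {x y} → Adjacent K x y → dist q y ≤ suc (dist q x)
    lipschitz {x} {y} a with dist q x <? q
    ... | yes lt = within⇒dist≤ q (inj₂ (x , dist<⇒within q lt , a))
    ... | no ≮q = m≤n⇒m≤1+n (≤-trans (dist≤ q y) (≮⇒≥ ≮q))

    -- Reaching `x` in `i` steps, then taking the edge and the rest of `P`, costs at most `q` edges.
    -- This walk is therefore `P`, and `x` is its vertex at position `i`.
    below : ∀ {i x} → i < q → Adjacent K x (at P (suc i)) → dist q x ≡ i → x ≡ at P i
    below {i} {x} i<q a eq with within⇒walk i (subst (λ j → Within j x) eq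
      (dist<⇒within q (subst (_< q) (sym eq) i<q))) | suffix P (suc i) i<q
    ... | W , le | S , leq = trans (sym (at-⊕ W _)) (cong₂ at W≡P lenW≡i)
      where
      W≡P : W ⊕ go (edge {G = K} a) S ≡ P
      W≡P = uniqueAmongWalks usp _ (begin
        len (W ⊕ go _ S)  ≡⟨ len-⊕ W _ ⟩
        len W + suc (len S) ≤⟨ +-monoˡ-≤ (suc (len S)) le ⟩
        i + suc (len S) ≡⟨ +-suc i (len S) ⟩
        suc i + len S ≡⟨ leq ⟩
        q ∎)
        where open ≤-Reasoning
      lenW≡i : len W ≡ i
      lenW≡i = +-cancelʳ-≡ (suc (len S)) (len W) i (trans (sym (len-⊕ W _))
        (trans (cong len W≡P) (trans (sym leq) (sym (+-suc i (len S))))))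

    simple : ∀ {i} → i < q → mult K (at P i) (at P (suc i)) ≤ 1
    simple {i} i<q with prefix P i (<⇒≤ i<q) | suffix P (suc i) i<q
    ... | W , eq | S , leq = fin⇒≤1 λ e f → ⊕-go-injective {G = K} W S (trans (≡P e) (sym (≡P f)))
      where
      ≡P : ∀ e → W ⊕ go e S ≡ P
      ≡P e = uniqueAmongWalks usp _ (≤-reflexive
        (trans (len-⊕ W _) (trans (cong (_+ suc (len S)) eq) (trans (+-suc i (len S)) leq))))

-- Branch sets of minors

Link : ∀ {N} → Graph N → (Fin N → Set) → Fin N → Fin N → Set
Link K S u w = S u × S w × Adjacent K u w

Fibre : ∀ {N n} → (Fin N → Maybe (Fin n)) → Fin n → Fin N → Set
Fibre φ x u = φ u ≡ just x

module _ {n N : ℕ} (K : Graph N) (φ : Fin N → Maybe (Fin n)) where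

  Joined : Fin n → Fin n → Set
  Joined x y = ∃₂ λ u w → Fibre φ x u × Fibre φ y w × Adjacent K u w

  -- Two host edges are told apart by their ends, or else by a multiplicity above one.
  record DoublyJoined (x y : Fin n) : Set where
    constructor doublyJoined
    field
      {u w u′ w′} : Fin N
      u∈  : Fibre φ x u
      w∈  : Fibre φ y w
      u′∈ : Fibre φ x u′
      w′∈ : Fibre φ y w′
      uw  : Adjacent K u w
      u′w′ : Adjacent K u′ w′
      distinct : u ≢ u′ ⊎ w ≢ w′ ⊎ 1 < mult K u w

  Realises : ℕ → Fin n → Fin n → Set
  Realises a x y = (0 < a → Joined x y) × (1 < a → DoublyJoined x y)

-- The branch sets of a minor; multiplicities are only tracked up to two.
record Model {n N : ℕ} (G : Graph n) (K : Graph N) : Set where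
  field
    φ         : Fin N → Maybe (Fin n)
    inhabited : ∀ x → ∃ (Fibre φ x)
    connected : ∀ {x u w} → Fibre φ x u → Fibre φ x w → Star (Link K (Fibre φ x)) u w
    realises  : ∀ x y → Realises K φ (mult G x y) x y

module _ {n N : ℕ} {K : Graph N} {φ : Fin N → Maybe (Fin n)} where

  doublyJoined-sym : ∀ {x y} → DoublyJoined K φ x y → DoublyJoined K φ y x
  doublyJoined-sym (doublyJoined u∈ w∈ u′∈ w′∈ a a′ d) =
    doublyJoined w∈ u∈ w′∈ u′∈ (adj-sym {G = K} a) (adj-sym {G = K} a′) (swap d)
    where
    swap : ∀ {u w u′ w′} → u ≢ u′ ⊎ w ≢ w′ ⊎ 1 < mult K u w → w ≢ w′ ⊎ u ≢ u′ ⊎ 1 < mult K w u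
    swap (inj₁ p) = inj₂ (inj₁ p)
    swap (inj₂ (inj₁ p)) = inj₁ p
    swap {u} {w} (inj₂ (inj₂ p)) = inj₂ (inj₂ (subst (1 <_) (mult-sym K u w) p))

  realises-sym : ∀ {a x y} → Realises K φ a x y → Realises K φ a y x
  realises-sym {a} {x} {y} (one , two) = joined-sym ∘ one , doublyJoined-sym ∘ two
    where
    joined-sym : Joined K φ x y → Joined K φ y x
    joined-sym (u , w , u∈ , w∈ , a) = w , u , w∈ , u∈ , adj-sym {G = K} a

  realises-≤ : ∀ {a b x y} → a ≤ b → Realises K φ b x y → Realises K φ a x y
  realises-≤ a≤b (one , two) = (λ p → one (<-≤-trans p a≤b)) , (λ p → two (<-≤-trans p a≤b))

  realises-mult : ∀ {x y u w} → Fibre φ x u → Fibre φ y w → Realises K φ (mult K u w) x y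
  realises-mult u∈ w∈ = (λ p → _ , _ , u∈ , w∈ , p) ,
    λ p → doublyJoined u∈ w∈ u∈ w∈ (<⇒≤ p) (<⇒≤ p) (inj₂ (inj₂ p))

  -- Contraction adds up the edges of the two merged vertices. If both summands are positive, the
  -- resulting edges differ in their ends `u` and `u′`; otherwise a single summand is the total.
  realises-+ : ∀ {x y u u′ w} → Fibre φ x u → Fibre φ x u′ → u ≢ u′ → Fibre φ y w →
    Realises K φ (mult K u w + mult K u′ w) x y
  realises-+ {x} {y} {u} {u′} {w} u∈ u′∈ u≢u′ w∈ with mult K u w in eq | mult K u′ w in eq′
  ... | zero | b = subst (λ b → Realises K φ b x y) eq′ (realises-mult u′∈ w∈)
  ... | suc a | zero = subst (λ b → Realises K φ b x y) (trans eq (sym (+-identityʳ (suc a))))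
                         (realises-mult u∈ w∈)
  ... | suc a | suc b = (λ _ → _ , _ , u∈ , w∈ , uw) ,
    λ _ → doublyJoined u∈ w∈ u′∈ w∈ uw (subst (0 <_) (sym eq′) z<s) (inj₁ u≢u′)
    where
    uw : 0 < mult K u w
    uw = subst (0 <_) (sym eq) z<s

spanningModel : ∀ {n N} {G : Graph n} {K : Graph N} (g : Fin N → Fin n) (h : Fin n → Fin N) →
  (∀ x → g (h x) ≡ x) → (∀ u → h (g u) ≡ u) → (∀ x y → mult G x y ≤ mult K (h x) (h y)) →
  Model G K
spanningModel {G = G} {K} g h gh hg le = record
  { φ = just ∘ g
  ; inhabited = λ x → h x , cong just (gh x)
  ; connected = λ p q → single (trans (sym (hg _))
      (trans (cong h (just-injective (trans p (sym q)))) (hg _)))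
  ; realises = λ x y → realises-≤ {K = K} (le x y)
      (realises-mult {K = K} (cong just (gh x)) (cong just (gh y)))
  }
  where
  single : ∀ {x u w} → u ≡ w → Star (Link K (Fibre (just ∘ g) x)) u w
  single refl = ε

deleteEdge-≤ : ∀ {n} {H G : Graph n} u v → mult H u v ≡ suc (mult G u v) →
  (∀ x y → ¬ (x ≡ u × y ≡ v) → ¬ (x ≡ v × y ≡ u) → mult G x y ≡ mult H x y) →
  ∀ x y → mult G x y ≤ mult H x y
deleteEdge-≤ {H = H} {G} u v fewer same x y with x Fin.≟ u | y Fin.≟ v | x Fin.≟ v | y Fin.≟ u
... | yes refl | yes refl | _ | _ = ≤-trans (n≤1+n _) (≤-reflexive (sym fewer))
... | _ | _ | yes refl | yes refl = subst₂ _≤_ (mult-sym G u v) (mult-sym H u v)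
  (≤-trans (n≤1+n _) (≤-reflexive (sym fewer)))
... | yes _ | no p | yes _ | no q = ≤-reflexive (same x y (p ∘ proj₂) (q ∘ proj₂))
... | yes _ | no p | no q | _ = ≤-reflexive (same x y (p ∘ proj₂) (q ∘ proj₁))
... | no p | _ | yes _ | no q = ≤-reflexive (same x y (p ∘ proj₁) (q ∘ proj₂))
... | no p | _ | no q | _ = ≤-reflexive (same x y (p ∘ proj₁) (q ∘ proj₁))

module _ {n : ℕ} (v : Fin (suc n)) (d : Maybe (Fin n)) where

  -- The inverse of punchIn v, with value d at v.
  fold : Fin (suc n) → Maybe (Fin n)
  fold u with v Fin.≟ u
  ... | yes _ = d
  ... | no v≢u = just (punchOut v≢u)

  fold-v : fold v ≡ d
  fold-v with v Fin.≟ v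
  ... | yes _ = refl
  ... | no v≢v = contradiction refl v≢v

  fold-punchIn : ∀ j → fold (punchIn v j) ≡ just j
  fold-punchIn j with v Fin.≟ punchIn v j
  ... | yes eq = contradiction (sym eq) (Fin.punchInᵢ≢i v j)
  ... | no ≢ = cong just (trans (Fin.punchOut-cong v refl) (Fin.punchOut-punchIn v))

  fold⁻¹ : ∀ {u x} → fold u ≡ just x → u ≡ punchIn v x ⊎ (u ≡ v × d ≡ just x)
  fold⁻¹ {u} eq with v Fin.≟ u
  fold⁻¹ {u} eq | yes refl = inj₂ (refl , eq)
  fold⁻¹ {u} refl | no v≢u = inj₁ (sym (Fin.punchIn-punchOut v≢u))

stepModel : ∀ {n N} {G : Graph n} {H : Graph N} → H ⟶ G → Model G H
stepModel {G = G} {H} (deleteEdge u v fewer same) =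
  spanningModel (λ x → x) (λ x → x) (λ _ → refl) (λ _ → refl) (deleteEdge-≤ {H = H} {G} u v fewer same)
stepModel {G = G} {H} (deleteVertex v _ same) = record
  { φ = φ
  ; inhabited = λ x → punchIn v x , fold-punchIn v nothing x
  ; connected = connected
  ; realises = λ x y → subst (λ a → Realises H φ a x y) (sym (same x y))
      (realises-mult {K = H} (fold-punchIn v nothing x) (fold-punchIn v nothing y))
  }
  where
  φ = fold v nothing
  connected : ∀ {x u w} → Fibre φ x u → Fibre φ x w → Star (Link H (Fibre φ x)) u w
  connected p q with fold⁻¹ v nothing p | fold⁻¹ v nothing q
  ... | inj₁ refl | inj₁ refl = ε
stepModel {G = G} {H} (contractEdge v w one merged rest) = record
  { φ = φ
  ; inhabited = λ x → punchIn v x , fold-punchIn v (just w) x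
  ; connected = connected
  ; realises = realises
  }
  where
  φ = fold v (just w)
  pin = fold-punchIn v (just w)
  vw : Adjacent H v (punchIn v w)
  vw = ≤-reflexive (sym one)
  connected : ∀ {x u w} → Fibre φ x u → Fibre φ x w → Star (Link H (Fibre φ x)) u w
  connected p q with fold⁻¹ v (just w) p | fold⁻¹ v (just w) q
  ... | inj₁ refl | inj₁ refl = ε
  ... | inj₂ (refl , _) | inj₂ (refl , _) = ε
  ... | inj₂ (refl , refl) | inj₁ refl = (p , q , vw) ◅ ε
  ... | inj₁ refl | inj₂ (refl , refl) = (p , q , adj-sym {G = H} vw) ◅ ε
  atMerged : ∀ y → y ≢ w → Realises H φ (mult G w y) w y
  atMerged y y≢w = subst (λ a → Realises H φ a w y) (sym (merged y y≢w))
    (realises-+ {K = H} (pin w) (fold-v v (just w)) (Fin.punchInᵢ≢i v w) (pin y))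
  realises : ∀ x y → Realises H φ (mult G x y) x y
  realises x y with x Fin.≟ w | y Fin.≟ w
  ... | yes refl | yes refl = subst (λ a → Realises H φ a w w) (sym (mult-loop G w))
    ((λ ()) , (λ ()))
  ... | yes refl | no y≢w = atMerged y y≢w
  ... | no x≢w | yes refl = subst (λ a → Realises H φ a x w) (mult-sym G w x)
    (realises-sym {K = H} (atMerged x x≢w))
  ... | no x≢w | no y≢w = subst (λ a → Realises H φ a x y) (sym (rest x y x≢w y≢w))
    (realises-mult {K = H} (pin x) (pin y))

module _ {n N M : ℕ} {G : Graph n} {K : Graph N} {H : Graph M} (GK : Model G K) (KH : Model K H) where
  private
    module GK = Model GK
    module KH = Model KH

  composite : Fin M → Maybe (Fin n)
  composite u = KH.φ u >>= GK.φ

  composite⁺ : ∀ {x c u} → Fibre KH.φ c u → Fibre GK.φ x c → Fibre composite x u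
  composite⁺ p q rewrite p = q

  composite⁻ : ∀ {x u} → Fibre composite x u → ∃[ c ] (Fibre KH.φ c u × Fibre GK.φ x c)
  composite⁻ {x} {u} p with KH.φ u
  ... | just c = c , refl , p

  composeModels : Model G H
  composeModels = record
    { φ = composite
    ; inhabited = inhabited
    ; connected = connected
    ; realises = λ x y → one , two
    }
    where
    inhabited : ∀ x → ∃ (Fibre composite x)
    inhabited x with GK.inhabited x
    ... | c , c∈ with KH.inhabited c
    ... | u , u∈ = u , composite⁺ u∈ c∈

    within : ∀ {x c u w} → Fibre GK.φ x c → Fibre KH.φ c u → Fibre KH.φ c w →
      Star (Link H (Fibre composite x)) u w
    within c∈ p q = gmap (λ u → u)
      (λ { (s , t , a) → composite⁺ s c∈ , composite⁺ t c∈ , a }) (KH.connected p q)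

    -- Each edge of the chain in `K` is replaced by an edge of `H` realising it; successive ones are
    -- linked inside the branch set of the vertex of `K` that they share.
    lift : ∀ {x c d u w} → Fibre GK.φ x c → Star (Link K (Fibre GK.φ x)) c d →
      Fibre KH.φ c u → Fibre KH.φ d w → Star (Link H (Fibre composite x)) u w
    lift c∈ ε p q = within c∈ p q
    lift c∈ ((_ , d∈ , a) ◅ r) p q with proj₁ (KH.realises _ _) a
    ... | u , w , u∈ , w∈ , uw =
      within c∈ p u∈ ◅◅ ((composite⁺ u∈ c∈ , composite⁺ w∈ d∈ , uw) ◅ lift d∈ r w∈ q)

    connected : ∀ {x u w} → Fibre composite x u → Fibre composite x w →
      Star (Link H (Fibre composite x)) u w
    connected p q with composite⁻ p | composite⁻ q
    ... | c , u∈ , c∈ | d , w∈ , d∈ = lift c∈ (GK.connected c∈ d∈) u∈ w∈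

    one : ∀ {x y} → Adjacent G x y → Joined H composite x y
    one a with proj₁ (GK.realises _ _) a
    ... | c , d , c∈ , d∈ , cd with proj₁ (KH.realises _ _) cd
    ... | u , w , u∈ , w∈ , uw = u , w , composite⁺ u∈ c∈ , composite⁺ w∈ d∈ , uw

    apart : ∀ {c c′ u u′} → Fibre KH.φ c u → Fibre KH.φ c′ u′ → c ≢ c′ → u ≢ u′
    apart p q c≢c′ refl = c≢c′ (just-injective (trans (sym p) q))

    -- Edges of `K` with different ends stay different in `H` because branch sets are disjoint; a
    -- multiple pair of `K` is itself doubly joined in `H`.
    two : ∀ {x y} → 1 < mult G x y → DoublyJoined H composite x y
    two {x} {y} a with proj₂ (GK.realises _ _) a
    ... | doublyJoined {c} {d} {c′} {d′} c∈ d∈ c′∈ d′∈ cd c′d′ (inj₂ (inj₂ p))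
        with proj₂ (KH.realises _ _) p
    ...   | doublyJoined u∈ w∈ u′∈ w′∈ uw u′w′ δ = doublyJoined
            (composite⁺ u∈ c∈) (composite⁺ w∈ d∈) (composite⁺ u′∈ c∈) (composite⁺ w′∈ d∈) uw u′w′ δ
    two {x} {y} a | doublyJoined {c} {d} {c′} {d′} c∈ d∈ c′∈ d′∈ cd c′d′ (inj₁ p)
        with proj₁ (KH.realises _ _) cd | proj₁ (KH.realises _ _) c′d′
    ...   | u , w , u∈ , w∈ , uw | u′ , w′ , u′∈ , w′∈ , u′w′ = doublyJoined
            (composite⁺ u∈ c∈) (composite⁺ w∈ d∈) (composite⁺ u′∈ c′∈) (composite⁺ w′∈ d′∈) uw u′w′
            (inj₁ (apart u∈ u′∈ p))
    two {x} {y} a | doublyJoined {c} {d} {c′} {d′} c∈ d∈ c′∈ d′∈ cd c′d′ (inj₂ (inj₁ p))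
        with proj₁ (KH.realises _ _) cd | proj₁ (KH.realises _ _) c′d′
    ...   | u , w , u∈ , w∈ , uw | u′ , w′ , u′∈ , w′∈ , u′w′ = doublyJoined
            (composite⁺ u∈ c∈) (composite⁺ w∈ d∈) (composite⁺ u′∈ c′∈) (composite⁺ w′∈ d′∈) uw u′w′
            (inj₂ (inj₁ (apart w∈ w′∈ p)))

≅⇒model : ∀ {n N} {G : Graph n} {H : Graph N} → G ≅ H → Model G H
≅⇒model (π , same) = spanningModel (π ⟨$⟩ˡ_) (π ⟨$⟩ʳ_)
  (λ _ → inverseˡ π) (λ _ → inverseʳ π) (λ x y → ≤-reflexive (same x y))

≼⇒model : ∀ {n N} {G : Graph n} {H : Graph N} → G ≼ H → Model G H
≼⇒model (iso G≅H) = ≅⇒model G≅H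
≼⇒model (step H⟶K G≼K) = composeModels (≼⇒model G≼K) (stepModel H⟶K)

-- The branch sets inside the parade of a host graph

injective⇒surjective : ∀ {a b} {f : Fin a → Fin b} → Injective _≡_ _≡_ f → b ≤ a → ∀ y → ∃[ x ] f x ≡ y
injective⇒surjective {a} {suc b} {f} inj b≤a y with Fin.any? (λ x → f x Fin.≟ y)
... | yes hit = hit
... | no miss = contradiction (≤-trans b≤a (Fin.injective⇒≤ {f = λ x → punchOut (y≢f x)}
        λ {x} {x′} eq → inj (Fin.punchOut-injective (y≢f x) (y≢f x′) eq))) (<-irrefl refl)
  where
  y≢f : ∀ x → y ≢ f x
  y≢f x eq = miss (x , sym eq)

minimum : ∀ {n} {P : Fin n → Set} → (∀ x → Dec (P x)) → (f : Fin n → ℕ) →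
  (∀ x → ¬ P x) ⊎ ∃[ x ] (P x × ∀ y → P y → f x ≤ f y)
minimum {zero} P? f = inj₁ λ ()
minimum {suc n} {P} P? f with minimum (P? ∘ fsuc) (f ∘ fsuc) | P? fzero
... | inj₁ none | no ¬p = inj₁ λ { fzero → ¬p ; (fsuc x) → none x }
... | inj₁ none | yes p = inj₂ (fzero , p , λ { fzero _ → ≤-refl ; (fsuc x) q → contradiction q (none x) })
... | inj₂ (x , p , least) | no ¬p = inj₂ (fsuc x , p , λ { fzero q → contradiction q ¬p ; (fsuc y) q → least y q })
... | inj₂ (x , p , least) | yes p₀ with ≤-total (f fzero) (f (fsuc x))
...   | inj₁ le = inj₂ (fzero , p₀ , λ { fzero _ → ≤-refl ; (fsuc y) q → ≤-trans le (least y q) })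
...   | inj₂ ge = inj₂ (fsuc x , p , λ { fzero _ → ge ; (fsuc y) q → least y q })

-- What a host graph with spectator number s forces on its minor H: T is the
-- set of vertices whose branch set lies inside the host's parade.
record Span {n : ℕ} (H : Graph n) (s : ℕ) : Set₁ where
  field
    T      : Fin n → Set
    a b    : Fin n
    simple : ∀ {x y} → T x → T y → x ≢ y → mult H x y ≤ 1
    bound  : ∀ (Q : Walk H a b) → n ≤ ∣ Q ∣ᵥ + s
    tight  : ∀ (Q : Walk H a b) → ∣ Q ∣ᵥ + s ≡ n → ∀ x → (x ∈ vertices Q → T x) × (T x → x ∈ vertices Q)

module Spanning {n N q : ℕ} {H : Graph n} {K : Graph N} (M : Model H K) (S : Strip K q) where
  open Model M
  open Strip S

  fibre? : ∀ x w → Dec (Fibre φ x w)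
  fibre? x w = ≡-dec Fin._≟_ (φ w) (just x)

  fibre-unique : ∀ {x y w} → Fibre φ x w → Fibre φ y w → x ≡ y
  fibre-unique p p′ = just-injective (trans (sym p) p′)

  Interior : Fin n → Set
  Interior x = ∀ {w} → Fibre φ x w → OnSpine w

  Exposed : Fin n → Set
  Exposed x = ∃[ w ] (Fibre φ x w × ¬ OnSpine w)

  exposed? : ∀ x → Dec (Exposed x)
  exposed? x = Fin.any? (λ w → fibre? x w ×-dec ¬? (onSpine? w))

  ¬exposed⇒interior : ∀ {x} → ¬ Exposed x → Interior x
  ¬exposed⇒interior ¬e {w} w∈ = decidable-stable (onSpine? w) (λ ¬s → ¬e (w , w∈ , ¬s))

  interior⇒¬exposed : ∀ {x} → Interior x → ¬ Exposed x
  interior⇒¬exposed i (w , w∈ , ¬s) = ¬s (i w∈)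

  rep : Fin n → Fin N
  rep x = proj₁ (inhabited x)

  rep∈ : ∀ x → Fibre φ x (rep x)
  rep∈ x = proj₂ (inhabited x)

  -- For interior vertices the choice of representative does not affect the order, since their
  -- branch sets are disjoint subpaths.
  height : Fin n → ℕ
  height x = level (rep x)

  -- A discrete intermediate value theorem: the first edge leaving the levels up to `i` climbs by
  -- exactly one, by `lipschitz`.
  crossing : ∀ {A u w} → Star (Link K A) u w → ∀ i → level u ≤ i → i < level w →
    ∃₂ λ x y → A x × A y × Adjacent K x y × level x ≡ i × level y ≡ suc i
  crossing ε i u≤i i<w = contradiction (<-≤-trans i<w u≤i) (<-irrefl refl)
  crossing (_◅_ {u} {x} (u∈ , x∈ , ux) r) i u≤i i<w with level x ≤? i
  ... | yes x≤i = crossing r i x≤i i<w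
  ... | no x≰i = u , x , u∈ , x∈ , ux ,
      ≤-antisym u≤i (s≤s⁻¹ (≤-trans (≰⇒> x≰i) (lipschitz ux))) ,
      ≤-antisym (≤-trans (lipschitz ux) (s≤s u≤i)) (≰⇒> x≰i)

  -- Being connected, the branch set meets level `i`, and `v i` is the only spine vertex there.
  interior-convex : ∀ {x u w} i → Interior x → Fibre φ x u → Fibre φ x w →
    level u ≤ i → i ≤ level w → Fibre φ x (v i)
  interior-convex i int u∈ w∈ u≤i i≤w with m≤n⇒m<n∨m≡n i≤w
  ... | inj₂ refl = subst (Fibre φ _) (int w∈) w∈
  ... | inj₁ i<w with crossing (connected u∈ w∈) i u≤i i<w
  ...   | y , _ , y∈ , _ , _ , refl , _ = subst (Fibre φ _) (int y∈) y∈

  -- By convexity and disjointness, the branch set of `x` ends at the level of `u` and that of `y`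
  -- begins at the level of `w`. An edge spans at most one level, so it can only join these two
  -- extremes.
  sole-edge : ∀ {x y u w u′ w′} → Interior x → Interior y → x ≢ y →
    Fibre φ x u → Fibre φ y w → Fibre φ x u′ → Fibre φ y w′ →
    level w ≡ suc (level u) → Adjacent K u′ w′ → u ≡ u′ × w ≡ w′
  sole-edge {x} {y} {u} {w} {u′} {w′} intx inty x≢y u∈ w∈ u′∈ w′∈ eq u′w′ =
    trans (intx u∈) (trans (cong v (sym u′≡u)) (sym (intx u′∈))) ,
    trans (inty w∈) (trans (cong v (sym w′≡w)) (sym (inty w′∈)))
    where
    u′≤u : level u′ ≤ level u
    u′≤u = ≮⇒≥ λ u<u′ → x≢y (fibre-unique
      (interior-convex (suc (level u)) intx u∈ u′∈ (n≤1+n _) u<u′)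
      (subst (Fibre φ y) (trans (inty w∈) (cong v eq)) w∈))
    w≤w′ : level w ≤ level w′
    w≤w′ = ≮⇒≥ λ w′<w → x≢y (fibre-unique
      (subst (Fibre φ x) (intx u∈) u∈)
      (interior-convex (level u) inty w′∈ w∈ (s≤s⁻¹ (≤-trans w′<w (≤-reflexive eq)))
        (≤-trans (n≤1+n _) (≤-reflexive (sym eq)))))
    w′≤ : level w′ ≤ suc (level u′)
    w′≤ = lipschitz u′w′
    u′≡u : level u′ ≡ level u
    u′≡u = ≤-antisym u′≤u (s≤s⁻¹ (≤-trans (≤-reflexive (sym eq)) (≤-trans w≤w′ w′≤)))
    w′≡w : level w′ ≡ level w
    w′≡w = ≤-antisym (≤-trans w′≤ (≤-trans (s≤s u′≤u) (≤-reflexive (sym eq)))) w≤w′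

  ascending-simple : ∀ {x y} → Interior x → Interior y → x ≢ y → (d : DoublyJoined K φ x y) →
    level (DoublyJoined.w d) ≢ suc (level (DoublyJoined.u d))
  ascending-simple intx inty x≢y (doublyJoined {u} {w} u∈ w∈ u′∈ w′∈ uw u′w′ distinct) eq
    with sole-edge intx inty x≢y u∈ w∈ u′∈ w′∈ eq u′w′ | distinct
  ... | u≡ , _ | inj₁ u≢ = u≢ u≡
  ... | _ , w≡ | inj₂ (inj₁ w≢) = w≢ w≡
  ... | _ | inj₂ (inj₂ many) = <-irrefl refl (<-≤-trans many
    (subst₂ (λ u w → mult K u w ≤ 1) (sym (intx u∈)) (sym (trans (inty w∈) (cong v eq)))
      (v-simple (subst (_≤ q) eq (level≤ w)))))

  -- A spine edge joins successive levels: equal levels would give the two branch sets a common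
  -- vertex. Up to symmetry it ascends from `x` to `y`.
  interior-simple : ∀ {x y} → Interior x → Interior y → x ≢ y → mult H x y ≤ 1
  interior-simple {x} {y} intx inty x≢y = ≮⇒≥ (absurd ∘ proj₂ (realises x y))
    where
    absurd : ¬ DoublyJoined K φ x y
    absurd d@(doublyJoined {u} {w} u∈ w∈ _ _ uw _ _) with <-cmp (level u) (level w)
    ... | tri< lt _ _ = ascending-simple intx inty x≢y d (≤-antisym (lipschitz uw) lt)
    ... | tri≈ _ eq _ = x≢y (fibre-unique u∈ (subst (Fibre φ y)
            (trans (inty w∈) (trans (cong v (sym eq)) (sym (intx u∈)))) w∈))
    ... | tri> _ _ gt = ascending-simple inty intx (x≢y ∘ sym) (doublyJoined-sym {K = K} d)
            (≤-antisym (lipschitz (adj-sym {G = K} uw)) gt)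

  -- The spine vertices are counted together with the vertices of H, so that no
  -- subtraction occurs.
  module Packing (ℓ : ℕ) (g : Fin n → Fin ℓ ⊎ Fin N) (g-injective : ∀ {x y} → g x ≡ g y → x ≡ y)
                 (g-offSpine : ∀ {x w} → g x ≡ inj₂ w → ¬ OnSpine w) where

    pack : Fin n ⊎ Fin (suc q) → Fin ℓ ⊎ Fin N
    pack (inj₁ x) = g x
    pack (inj₂ i) = inj₂ (spine i)

    pack-injective : ∀ {z z′} → pack z ≡ pack z′ → z ≡ z′
    pack-injective {inj₁ x} {inj₁ y} eq = cong inj₁ (g-injective eq)
    pack-injective {inj₁ x} {inj₂ j} eq = contradiction (spine-onSpine j) (g-offSpine eq)
    pack-injective {inj₂ i} {inj₁ y} eq = contradiction (spine-onSpine i) (g-offSpine (sym eq))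
    pack-injective {inj₂ i} {inj₂ j} eq = cong inj₂ (spine-injective (inj₂-injective eq))

    packFin : Fin (n + suc q) → Fin (ℓ + N)
    packFin = join ℓ N ∘ pack ∘ splitAt n

    packFin-injective : Injective _≡_ _≡_ packFin
    packFin-injective {i} {j} eq = begin
      i                               ≡⟨ Fin.join-splitAt n (suc q) i ⟨
      join n (suc q) (splitAt n i)    ≡⟨ cong (join n (suc q)) (pack-injective {splitAt n i} {splitAt n j} (begin
        pack (splitAt n i)            ≡⟨ Fin.splitAt-join ℓ N _ ⟨
        splitAt ℓ (packFin i)         ≡⟨ cong (splitAt ℓ) eq ⟩
        splitAt ℓ (packFin j)         ≡⟨ Fin.splitAt-join ℓ N _ ⟩
        pack (splitAt n j)            ∎)) ⟩
      join n (suc q) (splitAt n j)    ≡⟨ Fin.join-splitAt n (suc q) j ⟩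
      j                               ∎
      where open ≡-Reasoning

    size : n + suc q ≤ ℓ + N
    size = Fin.injective⇒≤ packFin-injective

    hit : ℓ + N ≤ n + suc q → ∀ w → ¬ OnSpine w → ∃[ x ] g x ≡ inj₂ w
    hit le w off with injective⇒surjective packFin-injective le (join ℓ N (inj₂ w))
    ... | z , eq = preimage (splitAt n z) (trans (sym (Fin.splitAt-join ℓ N _))
            (trans (cong (splitAt ℓ) eq) (Fin.splitAt-join ℓ N (inj₂ w))))
      where
      preimage : ∀ z → pack z ≡ inj₂ w → ∃[ x ] g x ≡ inj₂ w
      preimage (inj₁ x) eq = x , eq
      preimage (inj₂ i) refl = contradiction (spine-onSpine i) off

  module Sweep {a b : Fin n} (inta : Interior a) (intb : Interior b)
    (a-least : ∀ {x} → Interior x → height a ≤ height x)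
    (b-greatest : ∀ {x} → Interior x → height x ≤ height b)
    (Q : Walk H a b) where

    Covered : Fin N → Set
    Covered w = ∃[ x ] (x ∈ vertices Q × Fibre φ x w)

    within : ∀ {x u w} → x ∈ vertices Q → Star (Link K (Fibre φ x)) u w → Star (Link K Covered) u w
    within x∈ = gmap (λ u → u) λ { (s , t , e) → (_ , x∈ , s) , (_ , x∈ , t) , e }

    trail : ∀ {c u w} (R : Walk H c b) → (∀ {x} → x ∈ vertices R → x ∈ vertices Q) →
      Fibre φ c u → Fibre φ b w → Star (Link K Covered) u w
    trail (stop _) sub u∈ w∈ = within (sub (here refl)) (connected u∈ w∈)
    trail (go {c} {d} e R) sub u∈ w∈ with proj₁ (realises c d) (edge⇒adj {G = H} e)
    ... | y , z , y∈ , z∈ , yz = within c∈ (connected u∈ y∈) ◅◅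
      (((_ , c∈ , y∈) , (_ , sub (there (first∈ R)) , z∈) , yz) ◅ trail R (sub ∘ there) z∈ w∈)
      where
      c∈ : c ∈ vertices Q
      c∈ = sub (here refl)

    crossingQ : ∀ i → height a ≤ i → i < height b →
      ∃₂ λ x y → Covered x × Covered y × Adjacent K x y × level x ≡ i × level y ≡ suc i
    crossingQ = crossing (trail Q (λ x∈ → x∈) (rep∈ a) (rep∈ b))

    coveredAt : ∀ i → height a ≤ i → i ≤ height b → ∃[ w ] (Covered w × level w ≡ i)
    coveredAt i a≤i i≤b with m≤n⇒m<n∨m≡n i≤b
    ... | inj₂ refl = rep b , (b , last∈ Q , rep∈ b) , refl
    ... | inj₁ i<b with crossingQ i a≤i i<b
    ...   | w , _ , w∈ , _ , _ , eq , _ = w , w∈ , eq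

    -- Keeps with each value of `target` the reason for the charge, so that injectivity and the
    -- equality case go by matching.
    data Image (x : Fin n) : Fin ∣ Q ∣ᵥ ⊎ Fin N → Set where
      visited  : ∀ {i} → lookup (vertices Q) i ≡ x → Image x (inj₁ i)
      exposed  : ∀ {w} → x ∉ vertices Q → Fibre φ x w → ¬ OnSpine w → Image x (inj₂ w)
      bypassed : ∀ {w} → x ∉ vertices Q → Interior x → Covered w → ¬ OnSpine w →
        rep x ≡ v (level w) → Image x (inj₂ w)

    image : ∀ x → ∃ (Image x)
    image x with x ∈? vertices Q
    ... | yes x∈ = inj₁ (index x∈) , visited (sym (lookup-index x∈))
    ... | no x∉ with exposed? x
    ...   | yes (w , w∈ , off) = inj₂ w , exposed x∉ w∈ off
    ...   | no ¬e with coveredAt (height x) (a-least (¬exposed⇒interior ¬e)) (b-greatest (¬exposed⇒interior ¬e))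
    ...     | w , w∈@(y , y∈ , y∋w) , eq = inj₂ w , bypassed x∉ intx w∈ off repx
      where
      intx : Interior x
      intx = ¬exposed⇒interior ¬e
      repx : rep x ≡ v (level w)
      repx = trans (intx (rep∈ x)) (cong v (sym eq))
      -- On the spine, `w` would be `rep x`, which makes `x` the vertex `y` of `Q`.
      off : ¬ OnSpine w
      off on = x∉ (subst (_∈ vertices Q) (fibre-unique y∋w
        (subst (Fibre φ x) (trans repx (sym on)) (rep∈ x))) y∈)

    -- An exposed vertex charges a branch set outside `Q`, a bypassed one a branch set of `Q`. Two
    -- bypassed vertices with the same charge have the same representative, the spine vertex on the
    -- level of the charge.
    image-injective : ∀ {x y z} → Image x z → Image y z → x ≡ y
    image-injective (visited p) (visited p′) = trans (sym p) p′
    image-injective (exposed _ p _) (exposed _ p′ _) = fibre-unique p p′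
    image-injective (exposed x∉ p _) (bypassed _ _ (y , y∈ , p′) _ _) =
      contradiction (subst (_∈ vertices Q) (fibre-unique p′ p) y∈) x∉
    image-injective (bypassed _ _ (y , y∈ , p′) _ _) (exposed x∉ p _) =
      contradiction (subst (_∈ vertices Q) (fibre-unique p′ p) y∈) x∉
    image-injective {x} {y} (bypassed _ _ _ _ p) (bypassed _ _ _ _ p′) =
      fibre-unique (subst (Fibre φ x) (trans p (sym p′)) (rep∈ x)) (rep∈ y)

    image-offSpine : ∀ {x z} → Image x z → ∀ {w} → z ≡ inj₂ w → ¬ OnSpine w
    image-offSpine (exposed _ _ off) refl = off
    image-offSpine (bypassed _ _ _ off _) refl = off

    target : Fin n → Fin ∣ Q ∣ᵥ ⊎ Fin N
    target x = proj₁ (image x)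

    target-injective : ∀ {x y} → target x ≡ target y → x ≡ y
    target-injective {x} {y} eq = image-injective (proj₂ (image x)) (subst (Image y) (sym eq) (proj₂ (image y)))

    target-offSpine : ∀ {x w} → target x ≡ inj₂ w → ¬ OnSpine w
    target-offSpine {x} = image-offSpine (proj₂ (image x))

    open Packing ∣ Q ∣ᵥ target target-injective target-offSpine public

    module Tight (le : ∣ Q ∣ᵥ + N ≤ n + suc q) where

      -- By `hit` every spectator is charged. A covered one lies in a branch set of `Q`, so no
      -- exposed vertex outside `Q` can charge it.
      bypasser : ∀ {w} → Covered w → ¬ OnSpine w →
        ∃[ x ] (target x ≡ inj₂ w × x ∉ vertices Q × Interior x × rep x ≡ v (level w))
      bypasser {w} (y , y∈ , y∋w) off with hit le w off
      ... | x , eq with subst (Image x) eq (proj₂ (image x))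
      ...   | exposed x∉ x∋w _ = contradiction (subst (_∈ vertices Q) (fibre-unique y∋w x∋w) y∈) x∉
      ...   | bypassed x∉ intx _ _ p = x , eq , x∉ , intx , p

      on≢off : ∀ {w w′} → Covered w → Covered w′ → level w ≡ level w′ → OnSpine w → OnSpine w′
      on≢off {w} {w′} (y , y∈ , y∋w) w′∈ eq on = decidable-stable (onSpine? w′) λ off′ →
        let x , _ , x∉ , _ , p = bypasser w′∈ off′ in
        x∉ (subst (_∈ vertices Q) (fibre-unique y∋w
          (subst (Fibre φ x) (trans p (trans (cong v (sym eq)) (sym on))) (rep∈ x))) y∈)

      -- Two covered spectators on one level are charged by interior vertices with the same
      -- representative, hence by one vertex, which has only one `target`.
      once : ∀ {w w′} → Covered w → Covered w′ → level w ≡ level w′ → w ≡ w′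
      once {w} {w′} w∈ w′∈ eq with onSpine? w | onSpine? w′
      ... | yes on | yes on′ = trans on (trans (cong v eq) (sym on′))
      ... | yes on | no off′ = contradiction (on≢off w∈ w′∈ eq on) off′
      ... | no off | yes on′ = contradiction (on≢off w′∈ w∈ (sym eq) on′) off
      ... | no off | no off′ with bypasser w∈ off | bypasser w′∈ off′
      ...   | x , gx , _ , _ , p | x′ , gx′ , _ , _ , p′ =
        inj₂-injective (trans (sym gx) (trans (cong target x≡x′) gx′))
        where
        x≡x′ : x ≡ x′
        x≡x′ = fibre-unique (subst (Fibre φ x) (trans p (trans (cong v eq) (sym p′))) (rep∈ x)) (rep∈ x′)

      -- Descending induction from the level of `rep b`, with `d` the depth below it. `Q` crosses
      -- from level `i` to `suc i`; the upper end is a spine vertex by induction, `below-v` then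
      -- fixes the lower end, and `once` identifies it with `w`.
      onSpineBetween : ∀ d i → i + d ≡ height b → height a ≤ i → ∀ {w} → Covered w → level w ≡ i → OnSpine w
      onSpineBetween zero i eq a≤i {w} w∈ refl =
        subst OnSpine (once (b , last∈ Q , rep∈ b) w∈ (trans (sym eq) (+-identityʳ _))) (intb (rep∈ b))
      onSpineBetween (suc d) i eq a≤i {w} w∈ refl with crossingQ i a≤i (≤-trans (m<m+n i z<s) (≤-reflexive eq))
      ... | x , y , x∈ , y∈ , xy , ex , ey =
        subst OnSpine (trans (sym x≡v) (once x∈ w∈ ex)) (v-onSpine (<⇒≤ i<q))
        where
        i<q : i < q
        i<q = ≤-trans (≤-reflexive (sym ey)) (level≤ y)
        y≡v : y ≡ v (suc i)
        y≡v = trans (onSpineBetween d (suc i) (trans (sym (+-suc i d)) eq) (m≤n⇒m≤1+n a≤i) y∈ ey) (cong v ey)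
        x≡v : x ≡ v i
        x≡v = below-v i<q (subst (Adjacent K x) y≡v xy) ex

      -- A covered spectator is charged by an interior vertex of the same height, so its level lies
      -- between those of `a` and `b`, where `onSpineBetween` applies.
      covered⇒onSpine : ∀ {w} → Covered w → OnSpine w
      covered⇒onSpine {w} w∈ = decidable-stable (onSpine? w) λ off →
        let x , _ , _ , intx , p = bypasser w∈ off
            level≡ : height x ≡ level w
            level≡ = trans (cong level p) (level-v (level≤ w))
            w≤b : level w ≤ height b
            w≤b = subst (_≤ height b) level≡ (b-greatest intx)
        in off (onSpineBetween (height b ∸ level w) (level w) (m+[n∸m]≡n w≤b)
                  (subst (height a ≤_) level≡ (a-least intx)) w∈ refl)

      visited⇔interior : ∀ x → (x ∈ vertices Q → Interior x) × (Interior x → x ∈ vertices Q)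
      visited⇔interior x = (λ x∈ w∈ → covered⇒onSpine (x , x∈ , w∈)) , back
        where
        back : Interior x → x ∈ vertices Q
        back intx with image x
        ... | _ , visited {i} refl = ∈-lookup i
        ... | _ , exposed _ w∈ off = contradiction (intx w∈) off
        ... | _ , bypassed _ _ w∈ off _ = contradiction (covered⇒onSpine w∈) off

  -- If no vertex is interior, each owns a spectator in its branch set, which is a packing with
  -- `ℓ = 0`. Otherwise interior vertices of extreme height serve as ends; minimising `q ∸ height x`
  -- finds the highest.
  spanOrFew : n ≤ N ∸ suc q ⊎ Span H (N ∸ suc q)
  spanOrFew with minimum (¬? ∘ exposed?) height | minimum (¬? ∘ exposed?) (λ x → q ∸ height x)
  ... | inj₁ none | _ = inj₁ (m+n≤o⇒m≤o∸n n size)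
    where
    exp : ∀ x → Exposed x
    exp x = decidable-stable (exposed? x) (none x)
    exp-injective : ∀ {x y} → inj₂ {A = Fin 0} (proj₁ (exp x)) ≡ inj₂ (proj₁ (exp y)) → x ≡ y
    exp-injective {x} {y} eq = fibre-unique (proj₁ (proj₂ (exp x)))
      (subst (Fibre φ y) (sym (inj₂-injective eq)) (proj₁ (proj₂ (exp y))))
    exp-offSpine : ∀ {x w} → inj₂ {A = Fin 0} (proj₁ (exp x)) ≡ inj₂ w → ¬ OnSpine w
    exp-offSpine {x} refl = proj₂ (proj₂ (exp x))
    open Packing 0 (inj₂ ∘ proj₁ ∘ exp) exp-injective exp-offSpine
  ... | inj₂ (a , ¬ea , _) | inj₁ none = contradiction ¬ea (none a)
  ... | inj₂ (a , ¬ea , least) | inj₂ (b , ¬eb , least′) = inj₂ record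
    { T = Interior
    ; a = a
    ; b = b
    ; simple = interior-simple
    ; bound = λ Q → subst (n ≤_) (+-∸-assoc ∣ Q ∣ᵥ q<N) (m+n≤o⇒m≤o∸n n (Sweep.size inta intb a-least b-greatest Q))
    ; tight = λ Q eq → Sweep.Tight.visited⇔interior inta intb a-least b-greatest Q (≤-reflexive (balance eq))
    }
    where
    inta : Interior a
    inta = ¬exposed⇒interior ¬ea
    intb : Interior b
    intb = ¬exposed⇒interior ¬eb
    a-least : ∀ {x} → Interior x → height a ≤ height x
    a-least {x} i = least x (interior⇒¬exposed i)
    b-greatest : ∀ {x} → Interior x → height x ≤ height b
    b-greatest {x} i = ∸-cancelʳ-≤ (level≤ (rep x)) (least′ x (interior⇒¬exposed i))
    balance : ∀ {ℓ} → ℓ + (N ∸ suc q) ≡ n → ℓ + N ≡ n + suc q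
    balance {ℓ} refl = trans (cong (ℓ +_) (sym (m∸n+n≡m q<N))) (sym (+-assoc ℓ (N ∸ suc q) (suc q)))

-- Crowded parades as interval graphs

-- A crowded parade c 0, …, c q as an interval graph: c i is the point i, and a
-- vertex outside adjacent to c i and c (suc i) is the interval [ i , suc i ].
record Intervals {n : ℕ} (G : Graph n) (q m : ℕ) : Set where
  field
    c       : ℕ → Fin n
    lo hi   : Fin n → ℕ
    lo≤hi   : ∀ x → lo x ≤ hi x
    hi≤1+lo : ∀ x → hi x ≤ suc (lo x)
    hi≤q    : ∀ x → hi x ≤ q
    lo-c    : ∀ {i} → i ≤ q → lo (c i) ≡ i
    hi-c    : ∀ {i} → i ≤ q → hi (c i) ≡ i
    point   : ∀ {x} → lo x ≡ hi x → x ≡ c (lo x)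
    meet : ∀ {x y} → x ≢ y → lo x ≤ hi y → lo y ≤ hi x → mult G x y ≡ m
    c-adj   : ∀ {i} → i < q → Adjacent G (c i) (c (suc i))

  Point : Fin n → Set
  Point x = lo x ≡ hi x

-- Supergraphs of an interval graph

module Maximality {n q m s : ℕ} {G H : Graph n} (I : Intervals G q m) (1≤q : 1 ≤ q) (1≤m : 1 ≤ m)
  (G≤H : ∀ x y → mult G x y ≤ mult H x y) (H≤m : ∀ x y → mult H x y ≤ m)
  (size : suc q + s ≡ n) where
  open Intervals I

  meet-adj : ∀ {x y} → x ≢ y → lo x ≤ hi y → lo y ≤ hi x → Adjacent H x y
  meet-adj x≢y p p′ = ≤-trans 1≤m (≤-trans (≤-reflexive (sym (meet x≢y p p′))) (G≤H _ _))

  meet-thin : ∀ {x y} → x ≢ y → lo x ≤ hi y → lo y ≤ hi x → mult H x y ≤ 1 → m ≤ 1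
  meet-thin x≢y p p′ le = ≤-trans (≤-reflexive (sym (meet x≢y p p′))) (≤-trans (G≤H _ _) le)

  step₁ : ∀ {x y} → Adjacent H x y → Walk H x y
  step₁ a = go (edge {G = H} a) (stop _)

  Middle : ℕ → ℕ → Fin n → Set
  Middle i j z = Point z × i ≤ lo z × hi z ≤ j

  c-middle : ∀ {i j t} → j ≤ q → i ≤ t → t ≤ j → Middle i j (c t)
  c-middle {i} {j} {t} j≤q i≤t t≤j = trans (lo-c t≤q) (sym (hi-c t≤q)) ,
    subst (i ≤_) (sym (lo-c t≤q)) i≤t , subst (_≤ j) (sym (hi-c t≤q)) t≤j
    where
    t≤q : t ≤ q
    t≤q = ≤-trans t≤j j≤q

  spine : ∀ d {i j} → i + d ≡ j → j ≤ q →
    Σ[ W ∈ Walk H (c i) (c j) ] (len W ≡ d × (∀ {z} → z ∈ vertices W → Middle i j z))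
  spine zero {i} {j} eq j≤q with trans (sym (+-identityʳ i)) eq
  ... | refl = stop (c i) , refl , λ { (here refl) → c-middle j≤q ≤-refl ≤-refl }
  spine (suc d) {i} {j} eq j≤q with spine d (trans (sym (+-suc i d)) eq) j≤q
  ... | W , l , mid = go e W , cong suc l , members
    where
    i<j : i < j
    i<j = ≤-trans (m<m+n i z<s) (≤-reflexive eq)
    e : Fin (mult H (c i) (c (suc i)))
    e = edge {G = H} (≤-trans (c-adj (≤-trans i<j j≤q)) (G≤H _ _))
    members : ∀ {z} → z ∈ vertices (go e W) → Middle i j z
    members (here refl) = c-middle j≤q ≤-refl (<⇒≤ i<j)
    members (there z∈) with mid z∈
    ... | p , le , le′ = p , <⇒≤ le , le′

  enter : ∀ x → Σ[ W ∈ Walk H x (c (hi x)) ]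
    (lo x + len W ≡ hi x × (∀ {z} → z ∈ vertices W → z ≡ x ⊎ z ≡ c (hi x)))
  enter x with m≤n⇒m<n∨m≡n (lo≤hi x)
  ... | inj₂ pt with trans (point pt) (cong c pt)
  ...   | x≡c = subst (Walk H x) x≡c (stop x) , trans (cong (lo x +_) (len-subst x≡c)) (trans (+-identityʳ _) pt) ,
          λ z∈ → inj₁ (members x≡c z∈)
    where
    len-subst : ∀ {y} (eq : x ≡ y) → len (subst (Walk H x) eq (stop x)) ≡ 0
    len-subst refl = refl
    members : ∀ {y z} (eq : x ≡ y) → z ∈ vertices (subst (Walk H x) eq (stop x)) → z ≡ x
    members refl (here refl) = refl
  enter x | inj₁ lt = step₁ (meet-adj x≢c (≤-trans (lo≤hi x) (≤-reflexive (sym (hi-c (hi≤q x)))))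
                        (≤-reflexive (lo-c (hi≤q x)))) ,
      trans (+-comm (lo x) 1) (≤-antisym lt (hi≤1+lo x)) ,
      λ { (here refl) → inj₁ refl ; (there (here refl)) → inj₂ refl }
    where
    x≢c : x ≢ c (hi x)
    x≢c eq = <-irrefl (trans (cong lo eq) (lo-c (hi≤q x))) lt

  leave : ∀ y → Σ[ W ∈ Walk H (c (lo y)) y ]
    (lo y + len W ≡ hi y × (∀ {z} → z ∈ vertices W → z ≡ y ⊎ z ≡ c (lo y)))
  leave y with m≤n⇒m<n∨m≡n (lo≤hi y)
  ... | inj₂ pt = subst (λ u → Walk H u y) y≡c (stop y) ,
        trans (cong (lo y +_) (len-subst y≡c)) (trans (+-identityʳ _) pt) , λ z∈ → inj₁ (members y≡c z∈)
    where
    y≡c : y ≡ c (lo y)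
    y≡c = point pt
    len-subst : ∀ {x} (eq : y ≡ x) → len (subst (λ u → Walk H u y) eq (stop y)) ≡ 0
    len-subst refl = refl
    members : ∀ {x z} (eq : y ≡ x) → z ∈ vertices (subst (λ u → Walk H u y) eq (stop y)) → z ≡ y
    members refl (here refl) = refl
  ... | inj₁ lt = step₁ (meet-adj c≢y (≤-trans (≤-reflexive (lo-c lo≤q)) (lo≤hi y))
                    (≤-reflexive (sym (hi-c lo≤q)))) ,
      trans (+-comm (lo y) 1) (≤-antisym lt (hi≤1+lo y)) ,
      λ { (here refl) → inj₂ refl ; (there (here refl)) → inj₁ refl }
    where
    lo≤q : lo y ≤ q
    lo≤q = ≤-trans (lo≤hi y) (hi≤q y)
    c≢y : c (lo y) ≢ y
    c≢y eq = <-irrefl (trans (sym (hi-c lo≤q)) (cong hi eq)) lt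

  -- The walk from `x` rightwards along the points to `y`. A proper interval at either end costs one
  -- edge, hence the length from `lo x` to `hi y`. The points next to the ends are recorded for
  -- `blunt-a` and `blunt-b`.
  record Route (x y : Fin n) : Set where
    field
      walk    : Walk H x y
      length≡ : lo x + len walk ≡ hi y
      members : ∀ {z} → z ∈ vertices walk → z ≡ x ⊎ z ≡ y ⊎ Middle (hi x) (lo y) z
      chi∈    : c (hi x) ∈ vertices walk
      clo∈    : c (lo y) ∈ vertices walk

  route : ∀ {x y} → hi x ≤ lo y → Route x y
  route {x} {y} le with enter x | spine (lo y ∸ hi x) (m+[n∸m]≡n le) (≤-trans (lo≤hi y) (hi≤q y)) | leave y
  ... | E , eqE , memE | W , eqW , memW | L , eqL , memL = record
    { walk = E ⊕ W ⊕ L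
    ; length≡ = begin
        lo x + len (E ⊕ W ⊕ L)              ≡⟨ cong (lo x +_) (trans (len-⊕ E _) (cong (len E +_) (len-⊕ W L))) ⟩
        lo x + (len E + (len W + len L))    ≡⟨ +-assoc (lo x) (len E) _ ⟨
        lo x + len E + (len W + len L)      ≡⟨ cong (_+ (len W + len L)) eqE ⟩
        hi x + (len W + len L)              ≡⟨ +-assoc (hi x) (len W) _ ⟨
        hi x + len W + len L                ≡⟨ cong (_+ len L) (trans (cong (hi x +_) eqW) (m+[n∸m]≡n le)) ⟩
        lo y + len L                        ≡⟨ eqL ⟩
        hi y                                ∎
    ; members = members
    ; chi∈ = ∈-⊕ʳ E _ (∈-⊕ˡ W L (first∈ W))
    ; clo∈ = ∈-⊕ʳ E _ (∈-⊕ʳ W L (first∈ L))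
    }
    where
    open ≡-Reasoning
    members : ∀ {z} → z ∈ vertices (E ⊕ W ⊕ L) → z ≡ x ⊎ z ≡ y ⊎ Middle (hi x) (lo y) z
    members z∈ with ∈-⊕⁻ E (W ⊕ L) z∈
    ... | inj₁ z∈E with memE z∈E
    ...   | inj₁ eq = inj₁ eq
    ...   | inj₂ refl = inj₂ (inj₂ (memW (first∈ W)))
    members z∈ | inj₂ z∈WL with ∈-⊕⁻ W L z∈WL
    ...   | inj₁ z∈W = inj₂ (inj₂ (memW z∈W))
    ...   | inj₂ z∈L with memL z∈L
    ...     | inj₁ eq = inj₂ (inj₁ eq)
    ...     | inj₂ refl = inj₂ (inj₂ (memW (last∈ W)))

  -- The diameter bound behind the lower bound on the spectator floor: a route stays within the
  -- points up to `q`, and overlapping intervals are adjacent.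
  shortWalk : ∀ x y → Σ[ W ∈ Walk H x y ] len W ≤ q
  shortWalk x y with x Fin.≟ y | hi x ≤? lo y | hi y ≤? lo x
  ... | yes refl | _ | _ = stop x , z≤n
  ... | no _ | yes le | _ = R.walk , ≤-trans (m≤n+m _ (lo x)) (≤-trans (≤-reflexive R.length≡) (hi≤q y))
    where module R = Route (route le)
  ... | no _ | _ | yes le = reverseWalk R.walk , ≤-trans (≤-reflexive (len-reverseWalk R.walk))
      (≤-trans (m≤n+m _ (lo y)) (≤-trans (≤-reflexive R.length≡) (hi≤q x)))
    where module R = Route (route le)
  ... | no x≢y | no ≰ | no ≰′ = step₁ (meet-adj x≢y (<⇒≤ (≰⇒> ≰′)) (<⇒≤ (≰⇒> ≰))) , 1≤q

  -- The span of H, with its bounds expressed by edges instead of vertices.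
  record Taut (a b : Fin n) : Set₁ where
    field
      T      : Fin n → Set
      simple : ∀ {x y} → T x → T y → x ≢ y → mult H x y ≤ 1
      far    : ∀ (Q : Walk H a b) → q ≤ len Q
      tight  : ∀ (Q : Walk H a b) → len Q ≤ q → ∀ x → (x ∈ vertices Q → T x) × (T x → x ∈ vertices Q)

  span⇒taut : (S : Span H s) → Taut (Span.a S) (Span.b S)
  span⇒taut S = record { T = T ; simple = simple ; far = far
    ; tight = λ Q le → tight Q (trans (cong (_+ s) (trans (∣∣ᵥ≡suc-len Q) (cong suc (≤-antisym le (far Q))))) size) }
    where
    open Span S
    far : ∀ (Q : Walk H a b) → q ≤ len Q
    far Q = s≤s⁻¹ (+-cancelʳ-≤ s (suc q) (suc (len Q))
      (subst₂ _≤_ (sym size) (cong (_+ s) (∣∣ᵥ≡suc-len Q)) (bound Q)))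

  taut-sym : ∀ {a b} → Taut a b → Taut b a
  taut-sym t = record { T = T ; simple = simple
    ; far = λ Q → subst (q ≤_) (len-reverseWalk Q) (far (reverseWalk Q))
    ; tight = λ Q le x → let into , outof = tight (reverseWalk Q) (subst (_≤ q) (sym (len-reverseWalk Q)) le) x in
        into ∘ ∈-reverseWalk⁺ Q , ∈-reverseWalk Q ∘ outof }
    where open Taut t

  -- Successive points are already joined in `G` by `c-adj`, so an edge of `H` of this kind is not
  -- an additional one.
  Consecutive : Fin n → Fin n → Set
  Consecutive x y = Point x × Point y × lo y ≡ suc (hi x) × mult H x y ≤ 1

  -- Overlapping ends are adjacent, so `far` forces `q ≤ 1`, and simplicity of the edge between them
  -- forces `m ≤ 1`. Disjoint intervals are then the points 0 and 1.
  module Crossed {a b : Fin n} (t : Taut a b) (loa≤lob : lo a ≤ lo b) (lob<hia : lo b < hi a) where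
    open Taut t

    a≢b : a ≢ b
    a≢b refl = contradiction (≤-trans 1≤q (far (stop a))) λ ()

    ab : Adjacent H a b
    ab = meet-adj a≢b (≤-trans loa≤lob (lo≤hi b)) (<⇒≤ lob<hia)

    q≤1 : q ≤ 1
    q≤1 = far (step₁ ab)

    m≤1 : m ≤ 1
    m≤1 = meet-thin a≢b (≤-trans loa≤lob (lo≤hi b)) (<⇒≤ lob<hia)
      (simple (proj₁ (tight (step₁ ab) 1≤q a) (here refl))
              (proj₁ (tight (step₁ ab) 1≤q b) (there (here refl))) a≢b)

    consecutive : ∀ {x y} → hi x < lo y → Consecutive x y
    consecutive {x} {y} lt = ≤-antisym (lo≤hi x) (≤-trans hix≤0 z≤n) , ≤-antisym (lo≤hi y) (≤-trans hiy≤1 loy≥1) ,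
      ≤-antisym (≤-trans (lo≤hi y) (≤-trans hiy≤1 (s≤s z≤n))) lt , ≤-trans (H≤m x y) m≤1
      where
      loy≥1 : 1 ≤ lo y
      loy≥1 = ≤-trans (s≤s z≤n) lt
      hiy≤1 : hi y ≤ 1
      hiy≤1 = ≤-trans (hi≤q y) q≤1
      hix≤0 : hi x ≤ 0
      hix≤0 = s≤s⁻¹ (≤-trans lt (≤-trans (lo≤hi y) hiy≤1))

  module Straight {a b : Fin n} (t : Taut a b) (hia≤lob : hi a ≤ lo b) where
    open Taut t
    open Route (route hia≤lob)

    -- The route from `a` to `b` has at least `q` edges, so it must use the whole range from 0 to
    -- `q`.
    loa≡0 : lo a ≡ 0
    loa≡0 = n≤0⇒n≡0 (+-cancelʳ-≤ (len walk) (lo a) 0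
      (≤-trans (≤-reflexive length≡) (≤-trans (hi≤q b) (far walk))))

    length≡hib : len walk ≡ hi b
    length≡hib = trans (cong (_+ len walk) (sym loa≡0)) length≡

    hib≡q : hi b ≡ q
    hib≡q = ≤-antisym (hi≤q b) (subst (q ≤_) length≡hib (far walk))

    walk-tight : len walk ≤ q
    walk-tight = ≤-reflexive (trans length≡hib hib≡q)

    T-members : ∀ {z} → T z → z ≡ a ⊎ z ≡ b ⊎ Middle (hi a) (lo b) z
    T-members = members ∘ proj₂ (tight walk walk-tight _)

    visited : ∀ {z} → z ∈ vertices walk → T z
    visited = proj₁ (tight walk walk-tight _)

    -- A proper interval `a` meets `c (hi a)` with full multiplicity `m`, while both lie in `T`.
    blunt-a : lo a < hi a → m ≤ 1
    blunt-a lt = meet-thin a≢c (≤-trans (lo≤hi a) (≤-reflexive (sym (hi-c (hi≤q a)))))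
      (≤-reflexive (lo-c (hi≤q a))) (simple (visited (first∈ walk)) (visited chi∈) a≢c)
      where
      a≢c : a ≢ c (hi a)
      a≢c eq = <-irrefl (trans (cong lo eq) (lo-c (hi≤q a))) lt

    blunt-b : lo b < hi b → m ≤ 1
    blunt-b lt = meet-thin c≢b (≤-trans (≤-reflexive (lo-c lo≤q)) (lo≤hi b))
      (≤-reflexive (sym (hi-c lo≤q))) (simple (visited clo∈) (visited (last∈ walk)) c≢b)
      where
      lo≤q : lo b ≤ q
      lo≤q = ≤-trans (lo≤hi b) (hi≤q b)
      c≢b : c (lo b) ≢ b
      c≢b eq = <-irrefl (trans (sym (hi-c lo≤q)) (cong hi eq)) lt

    -- The last alternative is the case x = c 0 ≠ a, where a is an interval [ 0 , 1 ].
    LeftReach : Fin n → Set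
    LeftReach x = ∃[ h ] Σ[ W ∈ Walk H a x ] (len W ≤ h ×
      ((h ≤ hi x × (x ≡ a → h ≡ 0)) ⊎ (h ≡ 1 × hi x ≡ 0 × hi a ≡ 1 × x ≢ a)))

    leftReach : ∀ x → LeftReach x
    leftReach x with x Fin.≟ a | hi a ≤? lo x
    ... | yes refl | _ = 0 , stop a , z≤n , inj₁ (z≤n , λ _ → refl)
    ... | no x≢a | yes le = hi x , R.walk , ≤-trans (m≤n+m _ (lo a)) (≤-reflexive R.length≡) ,
          inj₁ (≤-refl , λ x≡a → contradiction x≡a x≢a)
      where module R = Route (route le)
    -- Here `x` meets `a`, so one edge suffices; the bound 1 exceeds `hi x` only if `x` is the point
    -- 0.
    ... | no x≢a | no ≰ = 1 , step₁ (meet-adj (x≢a ∘ sym) (≤-trans (≤-reflexive loa≡0) z≤n) (<⇒≤ (≰⇒> ≰))) , ≤-refl ,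
          exceptional (hi x) refl
      where
      hia≤1 : hi a ≤ 1
      hia≤1 = subst (λ l → hi a ≤ suc l) loa≡0 (hi≤1+lo a)
      exceptional : ∀ h → hi x ≡ h → (1 ≤ hi x × (x ≡ a → 1 ≡ 0)) ⊎ (1 ≡ 1 × hi x ≡ 0 × hi a ≡ 1 × x ≢ a)
      exceptional zero eq = inj₂ (refl , eq , ≤-antisym hia≤1 (≤-trans (s≤s z≤n) (≰⇒> ≰)) , x≢a)
      exceptional (suc h) eq = inj₁ (≤-trans (s≤s z≤n) (≤-reflexive (sym eq)) , λ x≡a → contradiction x≡a x≢a)

    -- The last alternative is the case y = c q ≠ b.
    RightReach : Fin n → Set
    RightReach y = ∃[ l ] Σ[ W ∈ Walk H y b ] (len W + l ≤ q ×
      ((lo y ≤ l × (y ≡ b → l ≡ q)) ⊎ (suc l ≡ q × lo y ≡ q × l ≡ lo b × y ≢ b)))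

    rightReach : ∀ y → RightReach y
    rightReach y with y Fin.≟ b | hi y ≤? lo b
    ... | yes refl | _ = q , stop b , ≤-refl , inj₁ (≤-trans (lo≤hi b) (hi≤q b) , λ _ → refl)
    ... | no y≢b | yes le = lo y , R.walk , ≤-reflexive (trans (+-comm _ (lo y)) (trans R.length≡ hib≡q)) ,
          inj₁ (≤-refl , λ y≡b → contradiction y≡b y≢b)
      where module R = Route (route le)
    ... | no y≢b | no ≰ = last (m≤n⇒m<n∨m≡n (≤-trans (lo≤hi y) (hi≤q y)))
      where
      loy≤hib : lo y ≤ hi b
      loy≤hib = ≤-trans (≤-trans (lo≤hi y) (hi≤q y)) (≤-reflexive (sym hib≡q))
      W : Walk H y b
      W = step₁ (meet-adj y≢b loy≤hib (<⇒≤ (≰⇒> ≰)))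
      q≡ : suc (lo b) ≡ q
      q≡ = ≤-antisym (≤-trans (≰⇒> ≰) (hi≤q y)) (subst (_≤ suc (lo b)) hib≡q (hi≤1+lo b))
      last : lo y < q ⊎ lo y ≡ q → RightReach y
      last (inj₁ lt) = lo y , W , lt , inj₁ (≤-refl , λ y≡b → contradiction y≡b y≢b)
      last (inj₂ eq) = lo b , W , ≤-reflexive q≡ , inj₂ (q≡ , eq , refl , y≢b)

    module _ {x y : Fin n} (xy : Adjacent H x y) (lt : hi x < lo y) where

      x≢y : x ≢ y
      x≢y refl = <-irrefl refl (<-≤-trans lt (lo≤hi x))

      y≢a : y ≢ a
      y≢a refl = contradiction (≤-trans lt (≤-reflexive loa≡0)) λ ()

      x≢b : x ≢ b
      x≢b refl = <-irrefl hib≡q (<-≤-trans lt (≤-trans (lo≤hi y) (hi≤q y)))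

      -- The walk through the edge `xy` has at most `q` edges as soon as `h < l`. Tightness puts `x`
      -- and `y` in `T`, and a gap above one would contradict `far`.
      via : ∀ {h l} (W : Walk H a x) (W′ : Walk H y b) → len W ≤ h → len W′ + l ≤ q → h < l →
        T x × T y × l ≡ suc h
      via {h} {l} W W′ le le′ h<l =
        proj₁ (tight D D≤q x) (∈-⊕ˡ W _ (last∈ W)) ,
        proj₁ (tight D D≤q y) (∈-⊕ʳ W _ (there (first∈ W′))) ,
        ≤-antisym (+-cancelˡ-≤ q l (suc h) (begin
          q + l                   ≤⟨ +-monoˡ-≤ l (≤-trans (far D) D≤) ⟩
          suc h + len W′ + l      ≡⟨ +-assoc (suc h) (len W′) l ⟩
          suc h + (len W′ + l)    ≤⟨ +-monoʳ-≤ (suc h) le′ ⟩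
          suc h + q               ≡⟨ +-comm (suc h) q ⟩
          q + suc h               ∎)) h<l
        where
        open ≤-Reasoning
        D : Walk H a b
        D = W ⊕ go (edge {G = H} xy) W′
        D≤ : len D ≤ suc h + len W′
        D≤ = begin
          len D                  ≡⟨ len-⊕ W _ ⟩
          len W + suc (len W′)   ≡⟨ +-suc (len W) (len W′) ⟩
          suc (len W + len W′)   ≤⟨ s≤s (+-monoˡ-≤ (len W′) le) ⟩
          suc h + len W′         ∎
        D≤q : len D ≤ q
        D≤q = begin
          len D              ≤⟨ D≤ ⟩
          suc h + len W′     ≤⟨ +-monoˡ-≤ (len W′) h<l ⟩
          l + len W′         ≡⟨ +-comm l (len W′) ⟩
          len W′ + l         ≤⟨ le′ ⟩
          q                  ∎

      consecutive : Consecutive x y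
      consecutive with leftReach x | rightReach y
      ... | h , W , le , inj₁ (h≤ , start) | l , W′ , le′ , inj₁ (≤l , end)
          with via W W′ le le′ (≤-trans (s≤s h≤) (≤-trans lt ≤l))
      -- The chain `h ≤ hi x < lo y ≤ l` with `l ≡ suc h` leaves no slack.
      ... | Tx , Ty , refl = pointx (T-members Tx) , pointy (T-members Ty) , loy≡ , simple Tx Ty x≢y
        where
        hix≤h : hi x ≤ h
        hix≤h = s≤s⁻¹ (≤-trans lt ≤l)
        loy≡ : lo y ≡ suc (hi x)
        loy≡ = ≤-antisym (≤-trans ≤l (s≤s h≤)) lt
        pointx : x ≡ a ⊎ x ≡ b ⊎ Middle (hi a) (lo b) x → Point x
        pointx (inj₁ x≡a) = ≤-antisym (lo≤hi x) (≤-trans (subst (hi x ≤_) (start x≡a) hix≤h) z≤n)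
        pointx (inj₂ (inj₁ x≡b)) = contradiction x≡b x≢b
        pointx (inj₂ (inj₂ (p , _))) = p
        pointy : y ≡ a ⊎ y ≡ b ⊎ Middle (hi a) (lo b) y → Point y
        pointy (inj₁ y≡a) = contradiction y≡a y≢a
        pointy (inj₂ (inj₁ y≡b)) = ≤-antisym (lo≤hi y)
          (≤-trans (hi≤q y) (≤-trans (≤-reflexive (sym (end y≡b))) (≤-trans (s≤s h≤) lt)))
        pointy (inj₂ (inj₂ (p , _))) = p
      consecutive | h , W , le , inj₂ (refl , hix≡0 , hia≡1 , x≢a) | l , W′ , le′ , inj₁ (≤l , end) with 1 <? l
      -- The point 0 would lie in `T`, whose points start at `hi a`, which is 1.
      ... | yes 1<l = absurd (T-members (proj₁ (via W W′ le le′ 1<l)))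
        where
        absurd : x ≡ a ⊎ x ≡ b ⊎ Middle (hi a) (lo b) x → Consecutive x y
        absurd (inj₁ x≡a) = contradiction x≡a x≢a
        absurd (inj₂ (inj₁ x≡b)) = contradiction x≡b x≢b
        absurd (inj₂ (inj₂ (_ , le , _))) =
          contradiction (subst₂ _≤_ hia≡1 hix≡0 (≤-trans le (lo≤hi x))) λ ()
      -- Now `lo y` is 1, so `a` meets `y` directly and the walk `D` avoids `x`. Tightness of `D`
      -- makes `y` a point; the multiplicity is bounded through `blunt-a`.
      ... | no 1≮l = ≤-antisym (lo≤hi x) (≤-trans (≤-reflexive hix≡0) z≤n) ,
            pointy (T-members (proj₁ (tight D D≤q y) (there (first∈ W′)))) ,
            ≤-antisym (≤-trans loy≤1 (s≤s z≤n)) lt ,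
            ≤-trans (H≤m x y) (blunt-a (subst₂ _<_ (sym loa≡0) (sym hia≡1) ≤-refl))
        where
        l≤1 : l ≤ 1
        l≤1 = ≮⇒≥ 1≮l
        loy≤1 : lo y ≤ 1
        loy≤1 = ≤-trans ≤l l≤1
        loy≥1 : 1 ≤ lo y
        loy≥1 = ≤-trans (s≤s z≤n) lt
        D : Walk H a b
        D = go (edge {G = H} (meet-adj (y≢a ∘ sym) (≤-trans (≤-reflexive loa≡0) z≤n)
              (≤-trans loy≤1 (≤-reflexive (sym hia≡1))))) W′
        D≤q : len D ≤ q
        D≤q = ≤-trans (≤-reflexive (+-comm 1 (len W′)))
          (≤-trans (+-monoʳ-≤ (len W′) (≤-trans loy≥1 ≤l)) le′)
        pointy : y ≡ a ⊎ y ≡ b ⊎ Middle (hi a) (lo b) y → Point y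
        pointy (inj₁ y≡a) = contradiction y≡a y≢a
        pointy (inj₂ (inj₁ y≡b)) = ≤-antisym (lo≤hi y)
          (≤-trans (hi≤q y) (≤-trans (≤-reflexive (sym (end y≡b))) (≤-trans l≤1 loy≥1)))
        pointy (inj₂ (inj₂ (p , _))) = p
      consecutive | h , W , le , inj₁ (h≤ , start) | l , W′ , le′ , inj₂ (1+l≡q , loy≡q , l≡lob , y≢b) with h <? l
      ... | yes h<l = absurd (T-members (proj₁ (proj₂ (via W W′ le le′ h<l))))
        where
        absurd : y ≡ a ⊎ y ≡ b ⊎ Middle (hi a) (lo b) y → Consecutive x y
        absurd (inj₁ y≡a) = contradiction y≡a y≢a
        absurd (inj₂ (inj₁ y≡b)) = contradiction y≡b y≢b
        absurd (inj₂ (inj₂ (_ , _ , hiy≤))) =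
          contradiction (≤-trans (≤-reflexive (trans (cong suc (sym l≡lob)) (trans 1+l≡q (sym loy≡q))))
            (≤-trans (lo≤hi y) hiy≤)) (<-irrefl refl)
      -- The mirror image: `hi x` equals `lo b`, so `x` meets `b` and `D` avoids `y`.
      ... | no h≮l = pointx (T-members (proj₁ (tight D D≤q x) (∈-⊕ˡ W _ (last∈ W)))) ,
            ≤-antisym (lo≤hi y) (≤-trans (hi≤q y) (≤-reflexive (sym loy≡q))) ,
            ≤-antisym (≤-trans (≤-reflexive loy≡1+l) (s≤s l≤hix)) lt ,
            ≤-trans (H≤m x y) (blunt-b (≤-reflexive (trans (cong suc (sym l≡lob)) (trans 1+l≡q (sym hib≡q)))))
        where
        loy≡1+l : lo y ≡ suc l
        loy≡1+l = trans loy≡q (sym 1+l≡q)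
        hix≤l : hi x ≤ l
        hix≤l = s≤s⁻¹ (≤-trans lt (≤-reflexive loy≡1+l))
        l≤hix : l ≤ hi x
        l≤hix = ≤-trans (≮⇒≥ h≮l) h≤
        D : Walk H a b
        D = W ⊕ step₁ (meet-adj x≢b (≤-trans (lo≤hi x) (≤-trans hix≤l (≤-trans (≤-reflexive l≡lob) (lo≤hi b))))
              (≤-trans (≤-reflexive (sym l≡lob)) l≤hix))
        D≤q : len D ≤ q
        D≤q = ≤-trans (≤-reflexive (trans (len-⊕ W _) (+-comm _ 1))) (≤-trans (s≤s (≤-trans le (≤-trans h≤ hix≤l))) (≤-reflexive 1+l≡q))
        pointx : x ≡ a ⊎ x ≡ b ⊎ Middle (hi a) (lo b) x → Point x
        pointx (inj₁ x≡a) = ≤-antisym (lo≤hi x)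
          (≤-trans (≤-trans hix≤l (≮⇒≥ h≮l)) (≤-trans (≤-reflexive (start x≡a)) z≤n))
        pointx (inj₂ (inj₁ x≡b)) = contradiction x≡b x≢b
        pointx (inj₂ (inj₂ (p , _))) = p
      consecutive | h , W , le , inj₂ (refl , hix≡0 , hia≡1 , x≢a) | l , W′ , le′ , inj₂ (1+l≡q , loy≡q , l≡lob , y≢b)
          with 1 <? l
      ... | yes 1<l = absurd (T-members (proj₁ (via W W′ le le′ 1<l)))
        where
        absurd : x ≡ a ⊎ x ≡ b ⊎ Middle (hi a) (lo b) x → Consecutive x y
        absurd (inj₁ x≡a) = contradiction x≡a x≢a
        absurd (inj₂ (inj₁ x≡b)) = contradiction x≡b x≢b
        absurd (inj₂ (inj₂ (_ , le , _))) =
          contradiction (subst₂ _≤_ hia≡1 hix≡0 (≤-trans le (lo≤hi x))) λ ()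
      -- Both ends are proper intervals and touch at 1, so they are adjacent although `q` is at
      -- least 2.
      ... | no 1≮l = contradiction (far (step₁ (meet-adj a≢b (≤-trans (≤-reflexive loa≡0) z≤n)
              (≤-trans (≤-reflexive (sym l≡lob)) (≤-trans (≮⇒≥ 1≮l) (≤-reflexive (sym hia≡1)))))))
              (λ q≤1 → <-irrefl refl (≤-trans 1≤l (s≤s⁻¹ (≤-trans (≤-reflexive 1+l≡q) q≤1))))
        where
        1≤l : 1 ≤ l
        1≤l = ≤-trans (≤-reflexive (sym hia≡1)) (≤-trans hia≤lob (≤-reflexive (sym l≡lob)))
        a≢b : a ≢ b
        a≢b refl = contradiction (subst (1 ≤_) (trans l≡lob loa≡0) 1≤l) λ ()

  consecutive : ∀ {a b} → Taut a b → ∀ {x y} → Adjacent H x y → hi x < lo y → Consecutive x y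
  consecutive {a} {b} t xy lt with ≤-total (lo a) (lo b)
  consecutive {a} {b} t xy lt | inj₁ le with hi a ≤? lo b
  ... | yes hia≤ = Straight.consecutive t hia≤ xy lt
  ... | no ≰ = Crossed.consecutive t le (≰⇒> ≰) lt
  consecutive {a} {b} t xy lt | inj₂ le with hi b ≤? lo a
  ... | yes hib≤ = Straight.consecutive (taut-sym t) hib≤ xy lt
  ... | no ≰ = Crossed.consecutive (taut-sym t) le (≰⇒> ≰) lt

  H≤G-disjoint : Span H s → ∀ {x y} → hi x < lo y → mult H x y ≤ mult G x y
  H≤G-disjoint S {x} {y} lt with 0 <? mult H x y
  ... | no ≮ = ≤-trans (≮⇒≥ ≮) z≤n
  ... | yes xy with consecutive (span⇒taut S) xy lt
  ...   | px , py , eq , le = ≤-trans le (subst₂ (λ u w → 1 ≤ mult G u w)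
            (sym (trans (point px) (cong c px))) (sym (trans (point py) (cong c eq)))
            (c-adj (≤-trans lt (≤-trans (lo≤hi y) (hi≤q y)))))

  H≤G : Span H s → ∀ x y → mult H x y ≤ mult G x y
  H≤G S x y with x Fin.≟ y | lo x ≤? hi y | lo y ≤? hi x
  ... | yes refl | _ | _ = ≤-trans (≤-reflexive (mult-loop H x)) z≤n
  ... | no x≢y | yes p | yes p′ = ≤-trans (H≤m x y) (≤-reflexive (sym (meet x≢y p p′)))
  ... | no _ | _ | no ≰ = H≤G-disjoint S (≰⇒> ≰)
  ... | no _ | no ≰ | yes _ = subst₂ _≤_ (mult-sym H y x) (mult-sym G y x) (H≤G-disjoint S (≰⇒> ≰))

-- Minor maximality

module Crowded {n m : ℕ} {G : Graph n} {u w : Fin n} (P : Walk G u w) (crowded : IsCrowded P)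
  (saturated : IsSaturated m P) where
  open IsCrowded crowded
  private
    q : ℕ
    q = len P
  open Strip (strip P (proj₁ parade))

  data Place (x : Fin n) : Set where
    on  : ∀ {i} → i ≤ q → x ≡ v i → Place x
    off : ∀ {i} → i < q → x ∉ vertices P → Adjacent G x (v i) → Adjacent G x (v (suc i)) → Place x

  low high : ∀ {x} → Place x → ℕ
  low (on {i} _ _) = i
  low (off {i} _ _ _ _) = i
  high (on {i} _ _) = i
  high (off {i} _ _ _ _) = suc i

  -- A shortest path has no chords, as an edge raises the level by at most one.
  consecutive : ∀ {i j} → i ≤ q → j ≤ q → i < j → Adjacent G (v i) (v j) → j ≡ suc i
  consecutive i≤q j≤q i<j a =
    ≤-antisym (subst₂ (λ i j → j ≤ suc i) (level-v i≤q) (level-v j≤q) (lipschitz a)) i<j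

  place : ∀ x → Place x
  place x with x ∈? vertices P
  ... | yes x∈ with ∈⇒at P x∈
  ...   | i , i≤q , eq = on i≤q eq
  place x | no x∉ with exactlyTwo x x∉
  ... | a , b , a∈ , b∈ , a≢b , xa , xb , _ , ab with ∈⇒at P a∈ | ∈⇒at P b∈
  ...   | i , i≤q , refl | j , j≤q , refl with <-cmp i j
  ...     | tri≈ _ refl _ = contradiction refl a≢b
  ...     | tri< i<j _ _ with consecutive i≤q j≤q i<j ab
  ...       | refl = off i<j′ x∉ xa xb
    where
    i<j′ : i < q
    i<j′ = j≤q
  place x | no x∉ | a , b , a∈ , b∈ , a≢b , xa , xb , _ , ab | i , i≤q , refl | j , j≤q , refl | tri> _ _ j<i
      with consecutive j≤q i≤q j<i (adj-sym {G = G} ab)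
  ... | refl = off i≤q x∉ xb xa

  place-v : ∀ {i} → i ≤ q → (p : Place (v i)) → low p ≡ i × high p ≡ i
  place-v i≤q (on j≤q eq) with v-injective i≤q j≤q eq
  ... | refl = refl , refl
  place-v {i} i≤q (off _ v∉ _ _) = contradiction (at∈ P i) v∉

  outside-saturated : ∀ {x y} → x ∉ vertices P → Adjacent G x y → mult G x y ≡ m
  outside-saturated {x} {y} x∉ a = saturated x y (edge {G = G} a) λ
    { (inj₁ d∈) → x∉ (proj₁ (∈-darts⇒∈-vertices P d∈))
    ; (inj₂ d∈) → x∉ (proj₂ (∈-darts⇒∈-vertices P d∈)) }

  spine-saturated : ∀ {i x} → i ≤ q → (p : Place x) → x ∉ vertices P → low p ≤ i → i ≤ high p → mult G x (v i) ≡ m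
  spine-saturated i≤q (on {j} _ refl) x∉ _ _ = contradiction (at∈ P j) x∉
  spine-saturated i≤q (off {j} _ x∉ xj xsj) _ j≤i i≤sj with m≤n⇒m<n∨m≡n i≤sj
  ... | inj₂ refl = outside-saturated x∉ xsj
  ... | inj₁ i<sj with ≤-antisym (s≤s⁻¹ i<sj) j≤i
  ...   | refl = outside-saturated x∉ xj

  shared-saturated : ∀ {x y} i → x ∉ vertices P → y ∉ vertices P → x ≢ y →
    Adjacent G x (v i) → Adjacent G y (v i) → mult G x y ≡ m
  shared-saturated i x∉ y∉ x≢y xi yi = outside-saturated x∉ (common _ _ x∉ y∉ x≢y (v i , at∈ P i , xi , yi))

  -- Meeting intervals share an endpoint. Two outside vertices thus have a common neighbour on `P`,
  -- and `common` joins them; saturation fixes the multiplicity.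
  meet : ∀ {x y} (p : Place x) (p′ : Place y) → x ≢ y → low p ≤ high p′ → low p′ ≤ high p → mult G x y ≡ m
  meet (on _ refl) (on _ refl) x≢y le le′ = contradiction (cong v (≤-antisym le le′)) x≢y
  meet (on i≤q refl) p′@(off _ y∉ _ _) x≢y le le′ = trans (mult-sym G _ _) (spine-saturated i≤q p′ y∉ le′ le)
  meet p@(off _ x∉ _ _) (on j≤q refl) x≢y le le′ = spine-saturated j≤q p x∉ le le′
  meet (off {i} _ x∉ xi xsi) (off {j} _ y∉ yj ysj) x≢y le le′ with <-cmp i j
  ... | tri≈ _ refl _ = shared-saturated i x∉ y∉ x≢y xi yj
  ... | tri< i<j _ _ with ≤-antisym le′ i<j
  ...   | refl = shared-saturated j x∉ y∉ x≢y xsi yj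
  meet (off {i} _ x∉ xi xsi) (off {j} _ y∉ yj ysj) x≢y le le′ | tri> _ _ j<i with ≤-antisym le j<i
  ...   | refl = shared-saturated i x∉ y∉ x≢y xi ysj

  intervals : Intervals G q m
  intervals = record
    { c = v
    ; lo = λ x → low (place x)
    ; hi = λ x → high (place x)
    ; lo≤hi = λ x → low≤high (place x)
    ; hi≤1+lo = λ x → high≤ (place x)
    ; hi≤q = λ x → high≤q (place x)
    ; lo-c = λ i≤q → proj₁ (place-v i≤q (place _))
    ; hi-c = λ i≤q → proj₂ (place-v i≤q (place _))
    ; point = λ {x} → point (place x)
    ; meet = λ {x} {y} → meet (place x) (place y)
    ; c-adj = v-adj
    }
    where
    low≤high : ∀ {x} (p : Place x) → low p ≤ high p
    low≤high (on _ _) = ≤-refl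
    low≤high (off _ _ _ _) = n≤1+n _
    high≤ : ∀ {x} (p : Place x) → high p ≤ suc (low p)
    high≤ (on _ _) = n≤1+n _
    high≤ (off _ _ _ _) = ≤-refl
    high≤q : ∀ {x} (p : Place x) → high p ≤ q
    high≤q (on i≤q _) = i≤q
    high≤q (off i<q _ _ _) = i<q
    point : ∀ {x} (p : Place x) → low p ≡ high p → x ≡ v (low p)
    point (on _ eq) _ = eq
    point (off _ _ _ _) eq = contradiction eq λ ()

  spine-simple : ∀ {i j} → i ≤ q → j ≤ q → i < j → mult G (v i) (v j) ≤ 1
  spine-simple {i} {j} i≤q j≤q i<j with 0 <? mult G (v i) (v j)
  ... | no ≮ = ≤-trans (≮⇒≥ ≮) z≤n
  ... | yes a with consecutive i≤q j≤q i<j a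
  ...   | refl = v-simple j≤q

  outside-parallel : ∀ {x} y → x ∉ vertices P → mult G x y ≤ m
  outside-parallel {x} y x∉ with 0 <? mult G x y
  ... | no ≮ = ≤-trans (≮⇒≥ ≮) z≤n
  ... | yes a = ≤-reflexive (outside-saturated x∉ a)

  parallel : 1 ≤ m → ∀ x y → mult G x y ≤ m
  parallel 1≤m x y with place x | place y
  ... | off _ x∉ _ _ | _ = outside-parallel y x∉
  ... | on _ _ | off _ y∉ _ _ = subst (_≤ m) (mult-sym G y x) (outside-parallel x y∉)
  ... | on {i} i≤q refl | on {j} j≤q refl with <-cmp i j
  ...   | tri< i<j _ _ = ≤-trans (spine-simple i≤q j≤q i<j) 1≤m
  ...   | tri≈ _ refl _ = ≤-trans (≤-reflexive (mult-loop G (v i))) z≤n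
  ...   | tri> _ _ j<i = subst (_≤ m) (mult-sym G (v j) (v i)) (≤-trans (spine-simple j≤q i≤q j<i) 1≤m)

-- Reduction to spanning supergraphs

hostSpan : ∀ {n N s} {H : Graph n} {K : Graph N} → H ≼ K → SpectatorNumber K s → n ≤ s ⊎ Span H s
hostSpan {n} {N} {s} {H} H≼K (p , ((_ , _ , P , usp , ∣P∣≡p) , _) , s≡) =
  subst (λ s → n ≤ s ⊎ Span H s) (sym (trans s≡ (cong (N ∸_) (trans (sym ∣P∣≡p) (∣∣ᵥ≡suc-len P)))))
    (Spanning.spanOrFew (≼⇒model H≼K) (strip P usp))

≼⇒≤ : ∀ {n N} {G : Graph n} {H : Graph N} → G ≼ H → n ≤ N
≼⇒≤ (iso (π , _)) = ≤-reflexive (↔⇒≡ π)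
≼⇒≤ (step (deleteVertex _ _ _) G≼K) = m≤n⇒m≤1+n (≼⇒≤ G≼K)
≼⇒≤ (step (deleteEdge _ _ _ _) G≼K) = ≼⇒≤ G≼K
≼⇒≤ (step (contractEdge _ _ _ _ _) G≼K) = m≤n⇒m≤1+n (≼⇒≤ G≼K)

-- Vertex deletion and contraction lose a vertex, so only edge deletions and an isomorphism remain.
spanning : ∀ {n N} {G : Graph n} {H : Graph N} → G ≼ H → N ≤ n →
  Σ[ π ∈ Permutation n N ] (∀ x y → mult G x y ≤ mult H (π ⟨$⟩ʳ x) (π ⟨$⟩ʳ y))
spanning (iso (π , same)) _ = π , λ x y → ≤-reflexive (same x y)
spanning (step (deleteVertex _ _ _) G≼K) N≤n = contradiction (≤-trans N≤n (≼⇒≤ G≼K)) (<-irrefl refl)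
spanning (step (contractEdge _ _ _ _ _) G≼K) N≤n = contradiction (≤-trans N≤n (≼⇒≤ G≼K)) (<-irrefl refl)
spanning (step {H = H} {K} (deleteEdge u v fewer same) G≼K) N≤n with spanning G≼K N≤n
... | π , le = π , λ x y → ≤-trans (le x y) (deleteEdge-≤ {H = H} {K} u v fewer same _ _)

≅-≼ : ∀ {n n′ N} {G : Graph n} {G′ : Graph n′} {H : Graph N} → G ≅ G′ → G′ ≼ H → G ≼ H
≅-≼ (π , same) (iso (ρ , same′)) = iso (π ∘ₚ ρ , λ x y → trans (same x y) (same′ _ _))
≅-≼ G≅G′ (step s G′≼K) = step s (≅-≼ G≅G′ G′≼K)

relabel : ∀ {n N} → NonZero n → Permutation n N → Graph N → Graph n
relabel n≢0 π H = record
  { nonEmpty = n≢0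
  ; mult = λ x y → mult H (π ⟨$⟩ʳ x) (π ⟨$⟩ʳ y)
  ; mult-sym = λ x y → mult-sym H _ _
  ; mult-loop = λ x → mult-loop H _
  }

-- `G` is its own witness for the floor, with `lower` as the bound. A larger member `H` of the class
-- has the same order, so after relabelling it contains `G` on the same vertices and `rigid` applies
-- to its host.
minorMaximal : ∀ {n m k} {G : Graph n} → (∀ x y → mult G x y ≤ m) → SpectatorNumber G k →
  (∀ {N} {K : Graph N} {s} → G ≼ K → SpectatorNumber K s → k ≤ s) →
  (∀ {H : Graph n} → (∀ x y → mult G x y ≤ mult H x y) → (∀ x y → mult H x y ≤ m) →
    ∀ {N} {K : Graph N} → H ≼ K → SpectatorNumber K k → ∀ x y → mult H x y ≤ mult G x y) →
  MinorMaximal (BoundedClass n m k) G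
minorMaximal {n} {m} {k} {G} G≤m sp lower rigid =
  record { order = refl ; parallel = G≤m ; floor = (n , G , iso (idₚ , λ _ _ → refl) , sp) , λ K s → lower } ,
  maximal
  where
  maximal : ∀ {N} (H : Graph N) → BoundedClass n m k H → G ≼ H → H ≅ G
  maximal H record { order = N≡n ; parallel = H≤m ; floor = (_ , K , H≼K , spK) , _ } G≼H
      with spanning G≼H (≤-reflexive N≡n)
  ... | π , G≤H = flip π , λ x y → begin
      mult H x y
        ≡⟨ cong₂ (mult H) (inverseʳ π) (inverseʳ π) ⟨
      mult H (π ⟨$⟩ʳ (π ⟨$⟩ˡ x)) (π ⟨$⟩ʳ (π ⟨$⟩ˡ y))
        ≡⟨ ≤-antisym (rigid {relabel (nonEmpty G) π H} G≤H (λ _ _ → H≤m _ _)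
             (≅-≼ (π , λ _ _ → refl) H≼K) spK _ _) (G≤H _ _) ⟩
      mult G (π ⟨$⟩ˡ x) (π ⟨$⟩ˡ y) ∎
    where open ≡-Reasoning

crowdedMaximal : ∀ {n k m} → 1 ≤ m → (G : Graph n) {u w : Fin n} (P : Walk G u w) → 1 ≤ len P →
  suc (len P) + k ≡ n → IsCrowded P → IsSaturated m P → MinorMaximal (BoundedClass n m k) G
crowdedMaximal {n} {k} {m} 1≤m G P 1≤q size crowded saturated =
  minorMaximal G≤m (∣ P ∣ᵥ , proj₂ (IsCrowded.parade crowded) , k≡) lower rigid
  where
  open Crowded P crowded saturated
  G≤m : ∀ x y → mult G x y ≤ m
  G≤m = parallel 1≤m
  k≡ : k ≡ n ∸ ∣ P ∣ᵥ
  k≡ = trans (sym (m+n∸m≡n (suc (len P)) k)) (cong₂ _∸_ size (sym (∣∣ᵥ≡suc-len P)))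
  k≤n : k ≤ n
  k≤n = ≤-trans (m≤n+m k (suc (len P))) (≤-reflexive size)
  lower : ∀ {N} {K : Graph N} {s} → G ≼ K → SpectatorNumber K s → k ≤ s
  lower {s = s} G≼K spK with hostSpan G≼K spK
  ... | inj₁ n≤s = ≤-trans k≤n n≤s
  -- With `G` in the role of `H`, a walk of at most `q` edges between the ends of the span enters
  -- the bound.
  ... | inj₂ S with Maximality.shortWalk {H = G} intervals 1≤q 1≤m (λ _ _ → ≤-refl) G≤m size (Span.a S) (Span.b S)
  ...   | W , le = +-cancelˡ-≤ (suc (len P)) k s (begin
    suc (len P) + k   ≡⟨ size ⟩
    n                 ≤⟨ Span.bound S W ⟩
    ∣ W ∣ᵥ + s        ≡⟨ cong (_+ s) (∣∣ᵥ≡suc-len W) ⟩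
    suc (len W) + s   ≤⟨ +-monoˡ-≤ s (s≤s le) ⟩
    suc (len P) + s   ∎)
    where open ≤-Reasoning
  rigid : ∀ {H : Graph n} → (∀ x y → mult G x y ≤ mult H x y) → (∀ x y → mult H x y ≤ m) →
    ∀ {N} {K : Graph N} → H ≼ K → SpectatorNumber K k → ∀ x y → mult H x y ≤ mult G x y
  rigid G≤H H≤m H≼K spK with hostSpan H≼K spK
  ... | inj₁ n≤k = contradiction (≤-trans (≤-reflexive size) n≤k) (<⇒≱ (m<n+m k z<s))
  ... | inj₂ S = Maximality.H≤G intervals 1≤q 1≤m G≤H H≤m size S

completeMaximal : ∀ {k m} → 2 ≤ m → (G : Graph (k + 1)) → (∀ x y → x ≢ y → mult G x y ≡ m) →
  MinorMaximal (BoundedClass (k + 1) m k) G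
completeMaximal {k} {m} 2≤m G complete =
  minorMaximal G≤m (1 , ((o , o , stop o , singleton , refl) , atMost1) , sym (m+n∸n≡m k 1)) lower rigid
  where
  o : Fin (k + 1)
  o = subst Fin (+-comm 1 k) fzero
  G≤m : ∀ x y → mult G x y ≤ m
  G≤m x y with x Fin.≟ y
  ... | yes refl = ≤-trans (≤-reflexive (mult-loop G x)) z≤n
  ... | no x≢y = ≤-reflexive (complete x y x≢y)
  1≤∣∣ᵥ : ∀ {x y} (Q : Walk G x y) → 1 ≤ ∣ Q ∣ᵥ
  1≤∣∣ᵥ (stop _) = ≤-refl
  1≤∣∣ᵥ (go _ _) = s≤s z≤n
  singleton : IsUniqueShortestPath {G = G} (stop o)
  singleton = (([] ∷ []) , λ Q _ → 1≤∣∣ᵥ Q) , unique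
    where
    unique : ∀ (Q : Walk G o o) → IsPath Q → ∣ Q ∣ᵥ ≡ 1 → Q ≡ stop o
    unique (stop _) _ _ = refl
    unique (go _ W) _ eq = contradiction (suc-injective eq) (<⇒≢ (1≤∣∣ᵥ W) ∘ sym)
  edge-adj : ∀ {x y} → x ≢ y → Adjacent G x y
  edge-adj x≢y = ≤-trans (s≤s z≤n) (≤-trans 2≤m (≤-reflexive (sym (complete _ _ x≢y))))
  multiple : ∀ {x y} → x ≢ y → ¬ mult G x y ≤ 1
  multiple x≢y le = <-irrefl refl (≤-trans 2≤m (≤-trans (≤-reflexive (sym (complete _ _ x≢y))) le))
  atMost1 : ∀ {x y} (Q : Walk G x y) → IsUniqueShortestPath Q → ∣ Q ∣ᵥ ≤ 1
  atMost1 (stop _) _ = ≤-refl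
  atMost1 {x} {y} Q@(go e W) usp with x Fin.≟ y
  ... | yes refl = ≤-reflexive (cong ∣_∣ᵥ (sym (uniqueAmongWalks usp (stop x) z≤n)))
  ... | no x≢y = contradiction (fin⇒≤1 λ e f → ⊕-go-injective {G = G} (stop x) (stop y) (trans (≡Q e) (sym (≡Q f))))
          (multiple x≢y)
    where
    ≡Q : ∀ e → go e (stop y) ≡ Q
    ≡Q e = uniqueAmongWalks usp (go e (stop y)) (s≤s z≤n)
  lower : ∀ {N} {K : Graph N} {s} → G ≼ K → SpectatorNumber K s → k ≤ s
  lower {s = s} G≼K spK with hostSpan G≼K spK
  ... | inj₁ n≤s = ≤-trans (m≤m+n k 1) n≤s
  ... | inj₂ S with Span.a S Fin.≟ Span.b S
  ...   | yes a≡b = +-cancelʳ-≤ 1 k s (≤-trans (trivial a≡b) (≤-reflexive (+-comm 1 s)))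
    where
    trivial : Span.a S ≡ Span.b S → k + 1 ≤ 1 + s
    trivial a≡b = subst (λ b → (∀ (Q : Walk G (Span.a S) b) → k + 1 ≤ ∣ Q ∣ᵥ + s) → k + 1 ≤ 1 + s) a≡b
      (λ bound → bound (stop _)) (Span.bound S)
  ...   | no a≢b = +-cancelʳ-≤ 1 k s (≤-trans (s≤s⁻¹ (≤∧≢⇒< (Span.bound S Q) slack)) (≤-reflexive (+-comm 1 s)))
    where
    Q : Walk G (Span.a S) (Span.b S)
    Q = go (edge {G = G} (edge-adj a≢b)) (stop _)
    -- Equality would put both ends of the edge in `T`, where multiplicities are at most one,
    -- against `2 ≤ m`.
    slack : k + 1 ≢ 2 + s
    slack eq = multiple a≢b (Span.simple S (proj₁ (Span.tight S Q (sym eq) _) (here refl))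
      (proj₁ (Span.tight S Q (sym eq) _) (there (here refl))) a≢b)
  rigid : ∀ {H : Graph (k + 1)} → (∀ x y → mult G x y ≤ mult H x y) → (∀ x y → mult H x y ≤ m) →
    ∀ {N} {K : Graph N} → H ≼ K → SpectatorNumber K k → ∀ x y → mult H x y ≤ mult G x y
  rigid {H} _ H≤m _ _ x y with x Fin.≟ y
  ... | yes refl = ≤-trans (≤-reflexive (mult-loop H x)) z≤n
  ... | no x≢y = ≤-trans (H≤m x y) (≤-reflexive (sym (complete x y x≢y)))

theorem7p7 : (n k m : ℕ) →
    (k + 2 ≤ n × 1 ≤ m) ⊎ (k + 1 ≡ n × 2 ≤ m) →
    (G : Graph n) → SaturatedCrowdedParade m (n ∸ k) G →
    MinorMaximal (BoundedClass n m k) G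
theorem7p7 n k m (inj₂ (refl , 2≤m)) G sat =
  completeMaximal 2≤m G (subst (λ p → SaturatedCrowdedParade m p G) (m+n∸m≡n k 1) sat)
theorem7p7 n k m (inj₁ (k+2≤n , 1≤m)) G sat
  -- Since `2 ≤ n ∸ k`, the parade size has the form at which `SaturatedCrowdedParade` unfolds to a
  -- crowded parade.
  with n ∸ k in eq | m+n≤o⇒m≤o∸n 2 (≤-trans (≤-reflexive (+-comm 2 k)) k+2≤n)
... | suc (suc r) | _ with sat
...   | u , w , P , ∣P∣≡ , crowded , saturated = crowdedMaximal 1≤m G P 1≤len size crowded saturated
  where
  len≡ : suc (len P) ≡ suc (suc r)
  len≡ = trans (sym (∣∣ᵥ≡suc-len P)) ∣P∣≡
  1≤len : 1 ≤ len P
  1≤len = ≤-trans (s≤s z≤n) (≤-reflexive (sym (suc-injective len≡)))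
  size : suc (len P) + k ≡ n
  size = trans (cong (_+ k) (trans len≡ (sym eq))) (m∸n+n≡m (≤-trans (m≤m+n k 2) k+2≤n))
theorem7p7 n k m (inj₁ (k+2≤n , 1≤m)) G sat | suc zero | s≤s ()
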